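{- For integers $n\ge 1$ and $k\ge 0$ let $m_n$ be the number of Motzkin trees with $n$ vertices and let $p_{k,n}$ be the total number of $k$-protected vertices in all Motzkin trees with $n$ vertices, i.e. the number of pairs $(T,v)$ with $T$ a Motzkin tree on $n$ vertices and $v$ a $k$-protected vertex of $T$. Let $p_k=\lim_{n\to\infty}\frac{p_{k,n}}{n\,m_n}$ be the asymptotic proportion of $k$-protected vertices among all vertices of all Motzkin trees. Then these limits exist and, for every $k\ge 1$, $$p_k=\tfrac13\,p_{k-1}+\tfrac13\,p_{k-1}^2 .$$
   Context: A Motzkin tree (0-1-2 tree, unary-binary tree) is a rooted plane tree, with at least one vertex, in which every vertex has 0, 1 or 2 children (a single child carries no left/right distinction; two children are ordered). A leaf is a vertex with no children. The rank of a vertex $v$ is the length (number of edges) of the shortest path from $v$ to a leaf travelling strictly from parent to child; leaves have rank 0. A vertex is $k$-protected if its rank is at least $k$. -}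

module Defs where

open import Data.Nat.Base
  using (ℕ; zero; suc; _+_; _*_; _⊓_; _≤_; z≤n; s≤s; NonZero)
open import Data.Nat.Properties
  using (_≟_; _≤?_; ≤-trans; ≤-reflexive; ≤-antisym; m≤m+n; m≤n+m; m⊓n≤m; m⊓n≤n;
         ⊓-sel; m*n≢0)
open import Data.Integer.Base using (+_)
open import Data.Rational.Base as ℚ using (ℚ; 0ℚ; _/_)
open import Data.List.Base
  using (List; []; _∷_; _++_; map; filter; length; concatMap; cartesianProductWith)
open import Data.List.Properties using (length-map; length-++)
open import Data.List.Membership.Propositional using (_∈_; lose; find)
open import Data.List.Membership.Propositional.Properties
  using (∈-map⁺; ∈-map⁻; ∈-++⁺ˡ; ∈-++⁺ʳ; ∈-++⁻; ∈-filter⁺; ∈-filter⁻; ∈-cartesianProductWith⁺;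
         ∈-cartesianProductWith⁻; ∈-concatMap⁺; ∈-concatMap⁻)
open import Data.List.Relation.Unary.Any using (here; there)
open import Data.List.Relation.Unary.All as All using (All; []; _∷_)
open import Data.List.Relation.Unary.AllPairs using ([]; _∷_)
open import Data.List.Relation.Unary.Unique.Propositional using (Unique)
import Data.List.Relation.Unary.Unique.Propositional.Properties as Unique
open import Data.Empty using (⊥; ⊥-elim)
open import Data.Product.Base using (∃; ∃-syntax; _×_; _,_; proj₂)
open import Data.Sum.Base using (inj₁; inj₂)
open import Function.Bundles using (_⇔_; mk⇔; module Equivalence)
open import Relation.Nullary.Decidable using (Dec; map′)
open import Relation.Nullary.Negation using (¬_)
open import Relation.Binary.PropositionalEquality
  using (_≡_; _≢_; refl; trans; cong; cong₂; subst)

open Equivalence using (to; from)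

------------------------------------------------------------------------
-- Motzkin trees and their vertices

data MotzkinTree : Set where
  leaf   : MotzkinTree
  unary  : MotzkinTree → MotzkinTree
  binary : MotzkinTree → MotzkinTree → MotzkinTree

data Vertex : MotzkinTree → Set where
  root  : ∀ {T} → Vertex T
  below : ∀ {T} → Vertex T → Vertex (unary T)
  left  : ∀ {L R} → Vertex L → Vertex (binary L R)
  right : ∀ {L R} → Vertex R → Vertex (binary L R)

vertices : (T : MotzkinTree) → List (Vertex T)
vertices leaf         = root ∷ []
vertices (unary T)    = root ∷ map below (vertices T)
vertices (binary L R) = root ∷ map left (vertices L) ++ map right (vertices R)

size : MotzkinTree → ℕ
size T = length (vertices T)

------------------------------------------------------------------------
-- Rank and protected vertices

infix 4 _▷_

-- v ▷ w : w is a child of v.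
data _▷_ : ∀ {T} → Vertex T → Vertex T → Set where
  child  : ∀ {T} → root {unary T} ▷ below root
  childˡ : ∀ {L R} → root {binary L R} ▷ left root
  childʳ : ∀ {L R} → root {binary L R} ▷ right root
  below  : ∀ {T} {v w : Vertex T} → v ▷ w → below v ▷ below w
  left   : ∀ {L R} {v w : Vertex L} → v ▷ w → left {L} {R} v ▷ left w
  right  : ∀ {L R} {v w : Vertex R} → v ▷ w → right {L} {R} v ▷ right w

IsLeaf : ∀ {T} → Vertex T → Set
IsLeaf v = ∀ w → ¬ (v ▷ w)

-- Path v n w : a path with n edges from v to w, each step going from
-- parent to child.
data Path {T} : Vertex T → ℕ → Vertex T → Set where
  []  : ∀ {v} → Path v 0 v
  _∷_ : ∀ {v w u n} → v ▷ w → Path w n u → Path v (suc n) u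

record IsRank {T} (v : Vertex T) (r : ℕ) : Set where
  field
    attained : ∃[ u ] IsLeaf u × Path v r u
    minimal  : ∀ u n → IsLeaf u → Path v n u → r ≤ n

Protected : ℕ → ∀ {T} → Vertex T → Set
Protected k v = ∃[ r ] IsRank v r × k ≤ r

rank : ∀ {T} → Vertex T → ℕ
rank {leaf}       root      = 0
rank {unary T}    root      = suc (rank {T} root)
rank {binary L R} root      = suc (rank {L} root ⊓ rank {R} root)
rank              (below v) = rank v
rank              (left v)  = rank v
rank              (right v) = rank v

private
  path-below : ∀ {T} {v u : Vertex T} {n} → Path v n u → Path (below v) n (below u)
  path-below []      = []
  path-below (e ∷ p) = below e ∷ path-below p

  path-left : ∀ {L R} {v u : Vertex L} {n} → Path v n u → Path (left {L} {R} v) n (left u)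
  path-left []      = []
  path-left (e ∷ p) = left e ∷ path-left p

  path-right : ∀ {L R} {v u : Vertex R} {n} → Path v n u → Path (right {L} {R} v) n (right u)
  path-right []      = []
  path-right (e ∷ p) = right e ∷ path-right p

  path-below⁻ : ∀ {T} {v : Vertex T} {u n} → Path (below v) n u →
                ∃[ u′ ] u ≡ below u′ × Path v n u′
  path-below⁻ [] = _ , refl , []
  path-below⁻ (below e ∷ p) with u′ , eq , q ← path-below⁻ p = u′ , eq , e ∷ q

  path-left⁻ : ∀ {L R} {v : Vertex L} {u n} → Path (left {L} {R} v) n u →
               ∃[ u′ ] u ≡ left u′ × Path v n u′
  path-left⁻ [] = _ , refl , []
  path-left⁻ (left e ∷ p) with u′ , eq , q ← path-left⁻ p = u′ , eq , e ∷ q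

  path-right⁻ : ∀ {L R} {v : Vertex R} {u n} → Path (right {L} {R} v) n u →
                ∃[ u′ ] u ≡ right u′ × Path v n u′
  path-right⁻ [] = _ , refl , []
  path-right⁻ (right e ∷ p) with u′ , eq , q ← path-right⁻ p = u′ , eq , e ∷ q

  open IsRank

  isRank-below : ∀ {T} {v : Vertex T} {r} → IsRank v r → IsRank (below v) r
  isRank-below h .attained with u , l , p ← h .attained =
    below u , (λ { _ (below e) → l _ e }) , path-below p
  isRank-below h .minimal u n l p with u′ , refl , q ← path-below⁻ p =
    h .minimal u′ n (λ w e → l _ (below e)) q

  isRank-left : ∀ {L R} {v : Vertex L} {r} → IsRank v r → IsRank (left {L} {R} v) r
  isRank-left h .attained with u , l , p ← h .attained =
    left u , (λ { _ (left e) → l _ e }) , path-left p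
  isRank-left h .minimal u n l p with u′ , refl , q ← path-left⁻ p =
    h .minimal u′ n (λ w e → l _ (left e)) q

  isRank-right : ∀ {L R} {v : Vertex R} {r} → IsRank v r → IsRank (right {L} {R} v) r
  isRank-right h .attained with u , l , p ← h .attained =
    right u , (λ { _ (right e) → l _ e }) , path-right p
  isRank-right h .minimal u n l p with u′ , refl , q ← path-right⁻ p =
    h .minimal u′ n (λ w e → l _ (right e)) q

rank-isRank : ∀ {T} (v : Vertex T) → IsRank v (rank v)
rank-isRank {leaf} root = record
  { attained = root , (λ _ ()) , [] ; minimal = λ _ _ _ _ → z≤n }
rank-isRank {unary T} root = record
  { attained = let u , l , p = h .attained in u , l , child ∷ p
  ; minimal  = λ { _ _ l []          → ⊥-elim (l _ child)
                 ; u _ l (child ∷ p) → s≤s (h .minimal u _ l p) }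
  }
  where
  h = isRank-below (rank-isRank {T} root)
rank-isRank {binary L R} root = record
  { attained = att
  ; minimal  = λ { _ _ l []           → ⊥-elim (l _ childˡ)
                 ; u _ l (childˡ ∷ p) → s≤s (≤-trans (m⊓n≤m _ _) (hˡ .minimal u _ l p))
                 ; u _ l (childʳ ∷ p) → s≤s (≤-trans (m⊓n≤n (rank {L} root) _) (hʳ .minimal u _ l p)) }
  }
  where
  hˡ = isRank-left {R = R} (rank-isRank {L} root)
  hʳ = isRank-right {L = L} (rank-isRank {R} root)
  att : ∃[ u ] IsLeaf u × Path root (rank {binary L R} root) u
  att with ⊓-sel (rank {L} root) (rank {R} root)
  ... | inj₁ eq rewrite eq = let u , l , p = hˡ .attained in u , l , childˡ ∷ p
  ... | inj₂ eq rewrite eq = let u , l , p = hʳ .attained in u , l , childʳ ∷ p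
rank-isRank (below v) = isRank-below (rank-isRank v)
rank-isRank (left v)  = isRank-left (rank-isRank v)
rank-isRank (right v) = isRank-right (rank-isRank v)

isRank-unique : ∀ {T} {v : Vertex T} {r s} → IsRank v r → IsRank v s → r ≡ s
isRank-unique h h′ with u , l , p ← h .attained | u′ , l′ , p′ ← h′ .attained =
  ≤-antisym (h .minimal u′ _ l′ p′) (h′ .minimal u _ l p)

protected? : ∀ k {T} (v : Vertex T) → Dec (Protected k v)
protected? k v = map′
  (λ k≤r → rank v , rank-isRank v , k≤r)
  (λ { (_ , h , k≤r) → subst (k ≤_) (isRank-unique h (rank-isRank v)) k≤r })
  (k ≤? rank v)

------------------------------------------------------------------------
-- Counting

-- All trees with at most h levels of vertices, for structural recursion.
treesOfHeight : ℕ → List MotzkinTree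
treesOfHeight zero    = []
treesOfHeight (suc h) =
  leaf ∷ map unary (treesOfHeight h)
    ++ cartesianProductWith binary (treesOfHeight h) (treesOfHeight h)

-- A tree with n vertices has at most n levels, so none is missed.
motzkinTrees : ℕ → List MotzkinTree
motzkinTrees n = filter (λ T → size T ≟ n) (treesOfHeight n)

pointedTrees : ℕ → List (∃ Vertex)
pointedTrees n = concatMap (λ T → map (T ,_) (vertices T)) (motzkinTrees n)

protectedPairs : ℕ → ℕ → List (∃ Vertex)
protectedPairs k n = filter (λ (_ , v) → protected? k v) (pointedTrees n)

#trees : ℕ → ℕ
#trees n = length (motzkinTrees n)

#protected : ℕ → ℕ → ℕ
#protected k n = length (protectedPairs k n)

------------------------------------------------------------------------
-- The enumerations are complete and free of repetitions

private
  Unique-∷ : ∀ {A : Set} {x : A} {xs} → (∀ {y} → y ∈ xs → x ≢ y) → Unique xs → Unique (x ∷ xs)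
  Unique-∷ x∉ u = All.tabulate x∉ ∷ u

∈-vertices : ∀ {T} (v : Vertex T) → v ∈ vertices T
∈-vertices {leaf}       root = here refl
∈-vertices {unary _}    root = here refl
∈-vertices {binary _ _} root = here refl
∈-vertices (below v) = there (∈-map⁺ below (∈-vertices v))
∈-vertices (left v)  = there (∈-++⁺ˡ (∈-map⁺ left (∈-vertices v)))
∈-vertices (right v) = there (∈-++⁺ʳ _ (∈-map⁺ right (∈-vertices v)))

vertices-unique : ∀ T → Unique (vertices T)
vertices-unique leaf = [] ∷ []
vertices-unique (unary T) = Unique-∷
  (λ { i refl → root∉ i })
  (Unique.map⁺ (λ { refl → refl }) (vertices-unique T))
  where
  root∉ : root ∈ map below (vertices T) → ⊥
  root∉ i with ∈-map⁻ below i
  ... | _ , _ , ()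
vertices-unique (binary L R) = Unique-∷
  (λ { i refl → root∉ i })
  (Unique.++⁺ (Unique.map⁺ (λ { refl → refl }) (vertices-unique L))
              (Unique.map⁺ (λ { refl → refl }) (vertices-unique R))
              disjoint)
  where
  root∉ : root ∈ map left (vertices L) ++ map right (vertices R) → ⊥
  root∉ i with ∈-++⁻ (map left (vertices L)) i
  ... | inj₁ j with _ , _ , () ← ∈-map⁻ left j
  ... | inj₂ j with _ , _ , () ← ∈-map⁻ right j
  disjoint : ∀ {v} → ¬ (v ∈ map left (vertices L) × v ∈ map right (vertices R))
  disjoint (i , j) with ∈-map⁻ left i | ∈-map⁻ right j
  ... | _ , _ , refl | _ , _ , ()

size-unary : ∀ T → size (unary T) ≡ suc (size T)
size-unary T = cong suc (length-map below (vertices T))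

size-binary : ∀ L R → size (binary L R) ≡ suc (size L + size R)
size-binary L R = cong suc (trans
  (length-++ (map left (vertices L)))
  (cong₂ _+_ (length-map left (vertices L)) (length-map right (vertices R))))

∈-treesOfHeight : ∀ T h → size T ≤ h → T ∈ treesOfHeight h
∈-treesOfHeight leaf (suc h) _ = here refl
∈-treesOfHeight (unary T) (suc h) le rewrite size-unary T with s≤s le′ ← le =
  there (∈-++⁺ˡ (∈-map⁺ unary (∈-treesOfHeight T h le′)))
∈-treesOfHeight (binary L R) (suc h) le rewrite size-binary L R with s≤s le′ ← le =
  there (∈-++⁺ʳ _ (∈-cartesianProductWith⁺ binary
    (∈-treesOfHeight L h (≤-trans (m≤m+n (size L) (size R)) le′))
    (∈-treesOfHeight R h (≤-trans (m≤n+m (size R) (size L)) le′))))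

treesOfHeight-unique : ∀ h → Unique (treesOfHeight h)
treesOfHeight-unique zero = []
treesOfHeight-unique (suc h) = Unique-∷
  (λ { i refl → leaf∉ i })
  (Unique.++⁺ (Unique.map⁺ (λ { refl → refl }) (treesOfHeight-unique h))
              (Unique.cartesianProductWith⁺ binary (λ { refl → refl , refl })
                (treesOfHeight-unique h) (treesOfHeight-unique h))
              disjoint)
  where
  Ts = treesOfHeight h
  leaf∉ : leaf ∈ map unary Ts ++ cartesianProductWith binary Ts Ts → ⊥
  leaf∉ i with ∈-++⁻ (map unary Ts) i
  ... | inj₁ j with _ , _ , () ← ∈-map⁻ unary j
  ... | inj₂ j with _ , _ , _ , _ , () ← ∈-cartesianProductWith⁻ binary Ts Ts j
  disjoint : ∀ {T} → ¬ (T ∈ map unary Ts × T ∈ cartesianProductWith binary Ts Ts)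
  disjoint (i , j) with ∈-map⁻ unary i | ∈-cartesianProductWith⁻ binary Ts Ts j
  ... | _ , _ , refl | _ , _ , _ , _ , ()

∈-motzkinTrees : ∀ T {n} → T ∈ motzkinTrees n ⇔ size T ≡ n
∈-motzkinTrees T {n} = mk⇔
  (λ i → proj₂ (∈-filter⁻ (λ T → size T ≟ n) {xs = treesOfHeight n} i))
  (λ eq → ∈-filter⁺ (λ T → size T ≟ n) (∈-treesOfHeight T n (≤-reflexive eq)) eq)

motzkinTrees-unique : ∀ n → Unique (motzkinTrees n)
motzkinTrees-unique n = Unique.filter⁺ (λ T → size T ≟ n) (treesOfHeight-unique n)

∈-pointedTrees : ∀ {T} (v : Vertex T) {n} → (T , v) ∈ pointedTrees n ⇔ size T ≡ n
∈-pointedTrees {T} v {n} = mk⇔ size-of (λ eq →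
    ∈-concatMap⁺ pointings (lose (∈-motzkinTrees T .from eq) (∈-map⁺ (T ,_) (∈-vertices v))))
  where
  pointings = λ T → map {B = ∃ Vertex} (T ,_) (vertices T)
  size-of : (T , v) ∈ pointedTrees n → size T ≡ n
  size-of i with find (∈-concatMap⁻ pointings {xs = motzkinTrees n} i)
  ... | T′ , T′∈ , j with ∈-map⁻ (T′ ,_) j
  ... | _ , _ , refl = ∈-motzkinTrees T .to T′∈

pointedTrees-unique : ∀ n → Unique (pointedTrees n)
pointedTrees-unique n = go (motzkinTrees-unique n)
  where
  pointings = λ T → map {B = ∃ Vertex} (T ,_) (vertices T)
  go : ∀ {Ts} → Unique Ts → Unique (concatMap pointings Ts)
  go [] = []
  go {T ∷ Ts} (T∉ ∷ u) = Unique.++⁺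
    (Unique.map⁺ (λ { refl → refl }) (vertices-unique T)) (go u) disjoint
    where
    disjoint : ∀ {x} → ¬ (x ∈ pointings T × x ∈ concatMap pointings Ts)
    disjoint (i , j) with ∈-map⁻ (T ,_) i | find (∈-concatMap⁻ pointings {xs = Ts} j)
    ... | _ , _ , refl | T′ , T′∈ , j′ with ∈-map⁻ (T′ ,_) j′
    ... | _ , _ , refl = All.lookup T∉ T′∈ refl

∈-protectedPairs : ∀ {k n T} (v : Vertex T) →
                   (T , v) ∈ protectedPairs k n ⇔ (size T ≡ n × Protected k v)
∈-protectedPairs {k} {n} v = mk⇔
  (λ i → let j , pr = ∈-filter⁻ P? {xs = pointedTrees n} i in ∈-pointedTrees v .to j , pr)
  (λ (eq , pr) → ∈-filter⁺ P? (∈-pointedTrees v .from eq) pr)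
  where
  P? = λ ((_ , v) : ∃ Vertex) → protected? k v

protectedPairs-unique : ∀ k n → Unique (protectedPairs k n)
protectedPairs-unique k n =
  Unique.filter⁺ (λ (_ , v) → protected? k v) (pointedTrees-unique n)

------------------------------------------------------------------------
-- Proportions and limits

private
  chain : ℕ → MotzkinTree
  chain zero    = leaf
  chain (suc n) = unary (chain n)

  size-chain : ∀ n → size (chain n) ≡ suc n
  size-chain zero    = refl
  size-chain (suc n) = trans (size-unary (chain n)) (cong suc (size-chain n))

#trees-nonZero : ∀ n .{{_ : NonZero n}} → NonZero (#trees n)
#trees-nonZero (suc n) = inhabited (∈-motzkinTrees (chain n) .from (size-chain n))
  where
  inhabited : ∀ {T Ts} → T ∈ Ts → NonZero (length {A = MotzkinTree} Ts)
  inhabited (here _)  = _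
  inhabited (there _) = _

proportion : ℕ → (n : ℕ) .{{_ : NonZero n}} → ℚ
proportion k n {{n≢0}} =
  (+ #protected k n / (n * #trees n)) {{m*n≢0 n (#trees n) {{n≢0}} {{#trees-nonZero n}}}}

-- Convergence of a rational sequence indexed by the positive integers to a
-- rational limit; testing against rational ε is enough by density.  Rational
-- limits suffice here: every proportion of 0-protected vertices is 1, and the
-- recurrence produces rationals from rationals.
HasLimit : ((n : ℕ) .{{_ : NonZero n}} → ℚ) → ℚ → Set
HasLimit a l = ∀ ε → 0ℚ ℚ.< ε → ∃[ N ] ∀ n .{{_ : NonZero n}} → N ≤ n → ℚ.∣ a n ℚ.- l ∣ ℚ.< ε

module Submission where

-- Let M be the generating function of Motzkin trees, R k that of the trees whose
-- root has rank at least k, and P k that of the pairs (tree, k-protected vertex),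
-- so that P 0 counts all vertices.  Then M = z(1 + M + M²), R 0 = M,
-- R (k+1) = z(R k + (R k)²) and P k = R k · U with U = 1/(1 - z - 2zM).
-- Reducing M² by the equation of M, every R k is A(z) + B(z) M with polynomials
-- A and B, hence P k = A U + B P 0 is a *finite* combination of shifts of U and
-- P 0, and its coefficients are governed by the two ratios U(n)/U(n+1) → 1/3 and
-- P 0 (n)/U(n) → 1.  Both follow from the three-term recurrence of the central
-- trinomial coefficients U, which is obtained without differentiating a series:
-- P 0 (n) = n m_n holds by counting.  So p_k = A(1/3) + B(1/3), the value of R k
-- at z = 1/3, M = 1, and R (k+1) = z(R k + (R k)²) evaluates to the recurrence.

open import Defs
open import Data.Nat.Base as ℕ using (ℕ; zero; suc; _≥_; _∸_; z≤n; s≤s)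
open import Data.Product.Base using (Σ-syntax; ∃; ∃-syntax; _×_; _,_; proj₁; proj₂)
open import Relation.Binary.PropositionalEquality
  using (_≡_; _≢_; _≗_; refl; sym; trans; cong; cong₂; subst; subst₂; module ≡-Reasoning)
import Data.Nat.Properties as ℕ
open import Data.Bool.Base using (true; false; if_then_else_)
open import Data.List.Base
  using (List; []; _∷_; _++_; map; filter; length; concatMap; cartesianProductWith)
open import Data.List.Properties using (map-++; map-∘; map-cong; filter-accept; filter-reject)
open import Data.List.Membership.Propositional using (_∈_)
open import Data.List.Membership.Propositional.Properties using (∈-filter⁺; ∈-filter⁻)
open import Data.List.Membership.Propositional.Properties.WithK using (unique∧set⇒bag)
open import Data.List.Relation.Binary.BagAndSetEquality using (∼bag⇒↭)
open import Data.List.Relation.Binary.Permutation.Propositional using (_↭_)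
open import Data.List.Relation.Binary.Permutation.Propositional.Properties using (map⁺)
open import Data.List.Relation.Unary.Any using (here; there)
import Data.List.Relation.Unary.Unique.Propositional.Properties as Unique
open import Data.Nat.ListAction using (sum)
open import Data.Nat.ListAction.Properties using (sum-++; sum-↭)
open import Data.Nat.Tactic.RingSolver using (solve-∀)
open import Function.Base using (_∘_)
open import Function.Bundles using (mk⇔; module Equivalence)
open import Relation.Nullary.Decidable using (Dec; does; yes; no)

-- Formal power series with natural number coefficients

module PowerSeries where
  open import Data.Nat.Base using (_+_; _*_; _≤_)
  open import Data.Nat.Properties

  Series : Set
  Series = ℕ → ℕ

  infixl 6 _⊕_
  infixl 7 _⊛_

  𝟘 𝟙 : Series
  𝟘 _ = 0
  𝟙 zero    = 1
  𝟙 (suc _) = 0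

  _⊕_ : Series → Series → Series
  (F ⊕ G) n = F n + G n

  _·_ : ℕ → Series → Series
  (c · F) n = c * F n

  z : Series → Series
  z F zero    = 0
  z F (suc n) = F n

  tail : Series → Series
  tail F n = F (suc n)

  -- The Cauchy product, obtained from F = F 0 + z (tail F). Recursion on the index replaces a
  -- finite sum, so most laws are direct inductions; the price is an asymmetry that `⊛-suc` repairs.
  _⊛_ : Series → Series → Series
  (F ⊛ G) zero    = F 0 * G 0
  (F ⊛ G) (suc n) = F 0 * G (suc n) + (tail F ⊛ G) n

  z-cong : ∀ {F G} → F ≗ G → z F ≗ z G
  z-cong F≗G zero    = refl
  z-cong F≗G (suc n) = F≗G n

  z-⊕ : ∀ F G → z (F ⊕ G) ≗ z F ⊕ z G
  z-⊕ F G zero    = refl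
  z-⊕ F G (suc n) = refl

  ⊕-cong : ∀ {F F′ G G′} → F ≗ F′ → G ≗ G′ → F ⊕ G ≗ F′ ⊕ G′
  ⊕-cong f g n = cong₂ _+_ (f n) (g n)

  -- Coefficient n of a product sees its factors only up to index n. Truncated enumerations and
  -- fixed-point equations both rely on this.
  ⊛-cong-≤ : ∀ {F F′ G G′} n → (∀ {i} → i ≤ n → F i ≡ F′ i) → (∀ {i} → i ≤ n → G i ≡ G′ i) →
             (F ⊛ G) n ≡ (F′ ⊛ G′) n
  ⊛-cong-≤ zero    f g = cong₂ _*_ (f z≤n) (g z≤n)
  ⊛-cong-≤ (suc n) f g = cong₂ _+_ (cong₂ _*_ (f z≤n) (g ≤-refl))
    (⊛-cong-≤ n (λ i≤n → f (s≤s i≤n)) (λ i≤n → g (m≤n⇒m≤1+n i≤n)))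

  ⊛-cong : ∀ {F F′ G G′} → F ≗ F′ → G ≗ G′ → F ⊛ G ≗ F′ ⊛ G′
  ⊛-cong f g n = ⊛-cong-≤ n (λ {i} _ → f i) (λ {i} _ → g i)

  ⊛-zeroˡ : ∀ G → 𝟘 ⊛ G ≗ 𝟘
  ⊛-zeroˡ G zero    = refl
  ⊛-zeroˡ G (suc n) = ⊛-zeroˡ G n

  ⊛-zeroʳ : ∀ F → F ⊛ 𝟘 ≗ 𝟘
  ⊛-zeroʳ F zero    = *-zeroʳ (F 0)
  ⊛-zeroʳ F (suc n) = cong₂ _+_ (*-zeroʳ (F 0)) (⊛-zeroʳ (tail F) n)

  ⊛-identityˡ : ∀ G → 𝟙 ⊛ G ≗ G
  ⊛-identityˡ G zero    = +-identityʳ (G 0)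
  ⊛-identityˡ G (suc n) = trans (cong₂ _+_ (+-identityʳ (G (suc n))) (⊛-zeroˡ G n)) (+-identityʳ _)

  ⊛-distribʳ-⊕ : ∀ H F G → (F ⊕ G) ⊛ H ≗ F ⊛ H ⊕ G ⊛ H
  ⊛-distribʳ-⊕ H F G zero    = *-distribʳ-+ (H 0) (F 0) (G 0)
  ⊛-distribʳ-⊕ H F G (suc n)
    rewrite ⊛-distribʳ-⊕ H (tail F) (tail G) n = lemma (F 0) (G 0) (H (suc n)) _ _
    where
    lemma : ∀ a b c x y → (a + b) * c + (x + y) ≡ a * c + x + (b * c + y)
    lemma = solve-∀

  ·-⊛ : ∀ c F G → (c · F) ⊛ G ≗ c · (F ⊛ G)
  ·-⊛ c F G zero    = *-assoc c (F 0) (G 0)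
  ·-⊛ c F G (suc n) rewrite ·-⊛ c (tail F) G n = lemma c (F 0) (G (suc n)) _
    where
    lemma : ∀ c a b x → c * a * b + c * x ≡ c * (a * b + x)
    lemma = solve-∀

  ⊛-assoc : ∀ F G H → (F ⊛ G) ⊛ H ≗ F ⊛ (G ⊛ H)
  ⊛-assoc F G H zero    = *-assoc (F 0) (G 0) (H 0)
  ⊛-assoc F G H (suc n) = begin
    F 0 * G 0 * H (suc n) + (((F 0 · tail G) ⊕ (tail F ⊛ G)) ⊛ H) n
      ≡⟨ cong (F 0 * G 0 * H (suc n) +_) (⊛-distribʳ-⊕ H (F 0 · tail G) (tail F ⊛ G) n) ⟩
    F 0 * G 0 * H (suc n) + (((F 0 · tail G) ⊛ H) n + ((tail F ⊛ G) ⊛ H) n)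
      ≡⟨ cong (F 0 * G 0 * H (suc n) +_)
           (cong₂ _+_ (·-⊛ (F 0) (tail G) H n) (⊛-assoc (tail F) G H n)) ⟩
    F 0 * G 0 * H (suc n) + (F 0 * (tail G ⊛ H) n + (tail F ⊛ (G ⊛ H)) n)
      ≡⟨ lemma (F 0) (G 0) (H (suc n)) _ _ ⟩
    F 0 * (G 0 * H (suc n) + (tail G ⊛ H) n) + (tail F ⊛ (G ⊛ H)) n ∎
    where
    open ≡-Reasoning
    lemma : ∀ a b c x y → a * b * c + (a * x + y) ≡ a * (b * c + x) + y
    lemma = solve-∀

  -- The mirror image of the defining clause: the constant term of the right factor is split off.
  -- Commutativity and `z-⊛ʳ` rest on it.
  ⊛-suc : ∀ F G n → (F ⊛ G) (suc n) ≡ F (suc n) * G 0 + (F ⊛ tail G) n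
  ⊛-suc F G zero    = +-comm (F 0 * G 1) (F 1 * G 0)
  ⊛-suc F G (suc n) rewrite ⊛-suc (tail F) G n =
    lemma (F 0 * G (suc (suc n))) (F (suc (suc n)) * G 0) _
    where
    lemma : ∀ x y w → x + (y + w) ≡ y + (x + w)
    lemma = solve-∀

  ⊛-comm : ∀ F G → F ⊛ G ≗ G ⊛ F
  ⊛-comm F G zero    = *-comm (F 0) (G 0)
  ⊛-comm F G (suc n) = begin
    F 0 * G (suc n) + (tail F ⊛ G) n  ≡⟨ cong₂ _+_ (*-comm (F 0) (G (suc n))) (⊛-comm (tail F) G n) ⟩
    G (suc n) * F 0 + (G ⊛ tail F) n  ≡⟨ ⊛-suc G F n ⟨
    (G ⊛ F) (suc n)                   ∎
    where open ≡-Reasoning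

  ⊛-distribˡ-⊕ : ∀ F G H → F ⊛ (G ⊕ H) ≗ F ⊛ G ⊕ F ⊛ H
  ⊛-distribˡ-⊕ F G H n = begin
    (F ⊛ (G ⊕ H)) n            ≡⟨ ⊛-comm F (G ⊕ H) n ⟩
    ((G ⊕ H) ⊛ F) n            ≡⟨ ⊛-distribʳ-⊕ F G H n ⟩
    (G ⊛ F) n + (H ⊛ F) n      ≡⟨ cong₂ _+_ (⊛-comm G F n) (⊛-comm H F n) ⟩
    (F ⊛ G) n + (F ⊛ H) n      ∎
    where open ≡-Reasoning

  z-⊛ˡ : ∀ F G → z F ⊛ G ≗ z (F ⊛ G)
  z-⊛ˡ F G zero    = refl
  z-⊛ˡ F G (suc n) = refl

  z-⊛ʳ : ∀ F G → F ⊛ z G ≗ z (F ⊛ G)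
  z-⊛ʳ F G zero    = *-zeroʳ (F 0)
  z-⊛ʳ F G (suc n) = trans (⊛-suc F (z G) n) (cong (_+ (F ⊛ G) n) (*-zeroʳ (F (suc n))))

open PowerSeries

-- Weighted generating functions of Motzkin trees

module GeneratingFunctions where
  open import Data.Nat.Base using (_+_; _*_; _≤_; _⊓_)
  open import Data.Nat.Properties

  monomial : ℕ → ℕ → Series
  monomial c zero    = c · 𝟙
  monomial c (suc s) = z (monomial c s)

  ·-identity-⊛ : ∀ c G → (c · 𝟙) ⊛ G ≗ c · G
  ·-identity-⊛ c G n = trans (·-⊛ c 𝟙 G n) (cong (c *_) (⊛-identityˡ G n))

  ·-monomial : ∀ c d s → c · monomial d s ≗ monomial (c * d) s
  ·-monomial c d zero    n       = sym (*-assoc c d (𝟙 n))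
  ·-monomial c d (suc s) zero    = *-zeroʳ c
  ·-monomial c d (suc s) (suc n) = ·-monomial c d s n

  monomial-⊛ : ∀ c s d t → monomial c s ⊛ monomial d t ≗ monomial (c * d) (s + t)
  monomial-⊛ c zero    d t n = trans (·-identity-⊛ c (monomial d t) n) (·-monomial c d t n)
  monomial-⊛ c (suc s) d t n =
    trans (z-⊛ˡ (monomial c s) (monomial d t) n) (z-cong (monomial-⊛ c s d t) n)

  monomial-hit : ∀ c s → monomial c s s ≡ c
  monomial-hit c zero    = *-identityʳ c
  monomial-hit c (suc s) = monomial-hit c s

  monomial-miss : ∀ c {s n} → s ≢ n → monomial c s n ≡ 0
  monomial-miss c {zero}  {zero}  s≢n with () ← s≢n refl
  monomial-miss c {zero}  {suc n} s≢n = *-zeroʳ c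
  monomial-miss c {suc s} {zero}  s≢n = refl
  monomial-miss c {suc s} {suc n} s≢n = monomial-miss c (s≢n ∘ cong suc)

  -- Summing monomials over an arbitrary finite list turns `++`, `map` and cartesian products of
  -- lists into operations on series; `gfOver-gf` then passes to `gf`.
  gfOver : List MotzkinTree → (MotzkinTree → ℕ) → Series
  gfOver []       w = 𝟘
  gfOver (T ∷ Ts) w = monomial (w T) (size T) ⊕ gfOver Ts w

  gf : (MotzkinTree → ℕ) → Series
  gf w n = sum (map w (motzkinTrees n))

  gfOver-filter : ∀ Ts w n → gfOver Ts w n ≡ sum (map w (filter (λ T → size T ≟ n) Ts))
  gfOver-filter []       w n = refl
  gfOver-filter (T ∷ Ts) w n with size T ≟ n
  ... | yes size≡n = begin
    monomial (w T) (size T) n + gfOver Ts w n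
      ≡⟨ cong₂ _+_ (trans (cong (monomial (w T) (size T)) (sym size≡n))
                          (monomial-hit (w T) (size T)))
                   (gfOver-filter Ts w n) ⟩
    sum (map w (T ∷ filter (λ T → size T ≟ n) Ts))
      ≡⟨ cong (sum ∘ map w) (filter-accept (λ T → size T ≟ n) {xs = Ts} size≡n) ⟨
    sum (map w (filter (λ T → size T ≟ n) (T ∷ Ts))) ∎
    where open ≡-Reasoning
  ... | no size≢n = begin
    monomial (w T) (size T) n + gfOver Ts w n
      ≡⟨ cong₂ _+_ (monomial-miss (w T) size≢n) (gfOver-filter Ts w n) ⟩
    sum (map w (filter (λ T → size T ≟ n) Ts))
      ≡⟨ cong (sum ∘ map w) (filter-reject (λ T → size T ≟ n) {x = T} {Ts} size≢n) ⟨
    sum (map w (filter (λ T → size T ≟ n) (T ∷ Ts))) ∎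
    where open ≡-Reasoning

  -- Both lists are free of repetitions and have the same members, since a tree with n vertices has
  -- at most n levels; hence one is a permutation of the other.
  treesOfHeight-stable : ∀ {n h} → n ≤ h →
                         filter (λ T → size T ≟ n) (treesOfHeight h) ↭ motzkinTrees n
  treesOfHeight-stable {n} {h} n≤h = ∼bag⇒↭ (unique∧set⇒bag
    (Unique.filter⁺ size? (treesOfHeight-unique h))
    (motzkinTrees-unique n)
    (λ {T} → mk⇔
      (λ T∈ → Equivalence.from (∈-motzkinTrees T) (proj₂ (∈-filter⁻ size? {xs = treesOfHeight h} T∈)))
      (λ T∈ → let eq = Equivalence.to (∈-motzkinTrees T) T∈ in
        ∈-filter⁺ size? (∈-treesOfHeight T h (≤-trans (≤-reflexive eq) n≤h)) eq)))
    where
    size? = λ T → size T ≟ n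

  gfOver-gf : ∀ w {n h} → n ≤ h → gfOver (treesOfHeight h) w n ≡ gf w n
  gfOver-gf w {n} {h} n≤h =
    trans (gfOver-filter (treesOfHeight h) w n) (sum-↭ (map⁺ w (treesOfHeight-stable n≤h)))

  gfOver-++ : ∀ w Ts Us → gfOver (Ts ++ Us) w ≗ gfOver Ts w ⊕ gfOver Us w
  gfOver-++ w []       Us n = refl
  gfOver-++ w (T ∷ Ts) Us n = trans
    (cong (monomial (w T) (size T) n +_) (gfOver-++ w Ts Us n))
    (sym (+-assoc (monomial (w T) (size T) n) _ _))

  gfOver-unary : ∀ w Ts → gfOver (map unary Ts) w ≗ z (gfOver Ts (w ∘ unary))
  gfOver-unary w []       zero    = refl
  gfOver-unary w []       (suc n) = refl
  gfOver-unary w (T ∷ Ts) n = trans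
    (cong₂ _+_ (cong (λ s → monomial (w (unary T)) s n) (size-unary T)) (gfOver-unary w Ts n))
    (sym (z-⊕ (monomial (w (unary T)) (size T)) (gfOver Ts (w ∘ unary)) n))

  module _ (w f g : MotzkinTree → ℕ) (w-binary : ∀ L R → w (binary L R) ≡ f L * g R) where

    gfOver-binaryˡ : ∀ L Rs →
                     gfOver (map (binary L) Rs) w ≗ z (monomial (f L) (size L) ⊛ gfOver Rs g)
    gfOver-binaryˡ L []       n = sym (trans (z-cong (⊛-zeroʳ (monomial (f L) (size L))) n) (z-𝟘 n))
      where
      z-𝟘 : z 𝟘 ≗ 𝟘
      z-𝟘 zero    = refl
      z-𝟘 (suc n) = refl
    gfOver-binaryˡ L (R ∷ Rs) n = begin
      monomial (w (binary L R)) (size (binary L R)) n + gfOver (map (binary L) Rs) w n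
        ≡⟨ cong₂ _+_ (cong₂ (λ c s → monomial c s n) (w-binary L R) (size-binary L R))
                     (gfOver-binaryˡ L Rs n) ⟩
      z (monomial (f L * g R) (size L + size R)) n + z (l ⊛ gfOver Rs g) n
        ≡⟨ z-⊕ (monomial (f L * g R) (size L + size R)) (l ⊛ gfOver Rs g) n ⟨
      z (monomial (f L * g R) (size L + size R) ⊕ l ⊛ gfOver Rs g) n
        ≡⟨ z-cong (⊕-cong (monomial-⊛ (f L) (size L) (g R) (size R)) (λ _ → refl)) n ⟨
      z (l ⊛ monomial (g R) (size R) ⊕ l ⊛ gfOver Rs g) n
        ≡⟨ z-cong (⊛-distribˡ-⊕ l (monomial (g R) (size R)) (gfOver Rs g)) n ⟨
      z (l ⊛ gfOver (R ∷ Rs) g) n ∎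
      where
      open ≡-Reasoning
      l = monomial (f L) (size L)

    gfOver-binary : ∀ Ls Rs →
                    gfOver (cartesianProductWith binary Ls Rs) w ≗ z (gfOver Ls f ⊛ gfOver Rs g)
    gfOver-binary []       Rs zero    = refl
    gfOver-binary []       Rs (suc n) = sym (⊛-zeroˡ (gfOver Rs g) n)
    gfOver-binary (L ∷ Ls) Rs n = begin
      gfOver (map (binary L) Rs ++ cartesianProductWith binary Ls Rs) w n
        ≡⟨ gfOver-++ w (map (binary L) Rs) _ n ⟩
      gfOver (map (binary L) Rs) w n + gfOver (cartesianProductWith binary Ls Rs) w n
        ≡⟨ cong₂ _+_ (gfOver-binaryˡ L Rs n) (gfOver-binary Ls Rs n) ⟩
      z (l ⊛ gfOver Rs g) n + z (gfOver Ls f ⊛ gfOver Rs g) n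
        ≡⟨ z-⊕ (l ⊛ gfOver Rs g) (gfOver Ls f ⊛ gfOver Rs g) n ⟨
      z (l ⊛ gfOver Rs g ⊕ gfOver Ls f ⊛ gfOver Rs g) n
        ≡⟨ z-cong (⊛-distribʳ-⊕ (gfOver Rs g) l (gfOver Ls f)) n ⟨
      z ((l ⊕ gfOver Ls f) ⊛ gfOver Rs g) n ∎
      where
      open ≡-Reasoning
      l = monomial (f L) (size L)

    -- The root is a leaf, has one child or has two, and in the last case the weight factors over
    -- the subtrees. Subtrees below the root of a tree with n + 1 vertices have at most n vertices,
    -- so `treesOfHeight n` already yields every coefficient involved.
    gf-decompose : gf w ≗ z (w leaf · 𝟙 ⊕ (gf (w ∘ unary) ⊕ gf f ⊛ gf g))
    gf-decompose zero    = refl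
    gf-decompose (suc n) = begin
      gf w (suc n)
        ≡⟨ gfOver-gf w (≤-refl {suc n}) ⟨
      (w leaf · 𝟙) n + gfOver (map unary Ts ++ cartesianProductWith binary Ts Ts) w (suc n)
        ≡⟨ cong ((w leaf · 𝟙) n +_) (gfOver-++ w (map unary Ts) _ (suc n)) ⟩
      (w leaf · 𝟙) n + (gfOver (map unary Ts) w (suc n)
                        + gfOver (cartesianProductWith binary Ts Ts) w (suc n))
        ≡⟨ cong ((w leaf · 𝟙) n +_)
             (cong₂ _+_ (gfOver-unary w Ts (suc n)) (gfOver-binary Ts Ts (suc n))) ⟩
      (w leaf · 𝟙) n + (gfOver Ts (w ∘ unary) n + (gfOver Ts f ⊛ gfOver Ts g) n)
        ≡⟨ cong ((w leaf · 𝟙) n +_)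
             (cong₂ _+_ (gfOver-gf (w ∘ unary) (≤-refl {n}))
                        (⊛-cong-≤ n (gfOver-gf f) (gfOver-gf g))) ⟩
      (w leaf · 𝟙) n + (gf (w ∘ unary) n + (gf f ⊛ gf g) n) ∎
      where
      open ≡-Reasoning
      Ts = treesOfHeight n

  gf-cong : ∀ {w w′} → w ≗ w′ → gf w ≗ gf w′
  gf-cong w≗w′ n = cong sum (map-cong w≗w′ (motzkinTrees n))

  sum-map-+ : ∀ {A : Set} (f g : A → ℕ) xs →
              sum (map (λ x → f x + g x) xs) ≡ sum (map f xs) + sum (map g xs)
  sum-map-+ f g []       = refl
  sum-map-+ f g (x ∷ xs) rewrite sum-map-+ f g xs = lemma (f x) (g x) _ _
    where
    lemma : ∀ a b c d → a + b + (c + d) ≡ a + c + (b + d)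
    lemma = solve-∀

  gf-+ : ∀ f g → gf (λ T → f T + g T) ≗ gf f ⊕ gf g
  gf-+ f g n = sum-map-+ f g (motzkinTrees n)

  -- Protected vertices as weights on trees

  atLeast : ℕ → ℕ → ℕ
  atLeast zero    r       = 1
  atLeast (suc k) zero    = 0
  atLeast (suc k) (suc r) = atLeast k r

  -- A minimum reaches k exactly when both arguments do. The product form is what `gf-decompose`
  -- asks of a weight on binary trees.
  atLeast-⊓ : ∀ k r s → atLeast k (r ⊓ s) ≡ atLeast k r * atLeast k s
  atLeast-⊓ zero    r       s       = refl
  atLeast-⊓ (suc k) zero    s       = refl
  atLeast-⊓ (suc k) (suc r) zero    = sym (*-zeroʳ (atLeast k r))
  atLeast-⊓ (suc k) (suc r) (suc s) = atLeast-⊓ k r s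

  atLeast-≤? : ∀ k r → (if does (k ≤? r) then 1 else 0) ≡ atLeast k r
  atLeast-≤? zero          r             = refl
  atLeast-≤? (suc k)       zero          = refl
  atLeast-≤? (suc zero)    (suc r)       = refl
  atLeast-≤? (suc (suc k)) (suc r)       = atLeast-≤? (suc k) r

  rootProtected : ℕ → MotzkinTree → ℕ
  rootProtected k T = atLeast k (rank {T} root)

  #protectedIn : ℕ → MotzkinTree → ℕ
  #protectedIn k T = sum (map (λ v → atLeast k (rank v)) (vertices T))

  length-filter-sum : ∀ {A : Set} {P : A → Set} (P? : ∀ x → Dec (P x)) xs →
                      length (filter P? xs) ≡ sum (map (λ x → if does (P? x) then 1 else 0) xs)
  length-filter-sum P? []       = refl
  length-filter-sum P? (x ∷ xs) with does (P? x)
  ... | true  = cong suc (length-filter-sum P? xs)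
  ... | false = length-filter-sum P? xs

  sum-concatMap : ∀ {A B : Set} (f : B → ℕ) (g : A → List B) xs →
                  sum (map f (concatMap g xs)) ≡ sum (map (λ x → sum (map f (g x))) xs)
  sum-concatMap f g []       = refl
  sum-concatMap f g (x ∷ xs) = begin
    sum (map f (g x ++ concatMap g xs))                ≡⟨ cong sum (map-++ f (g x) (concatMap g xs)) ⟩
    sum (map f (g x) ++ map f (concatMap g xs))        ≡⟨ sum-++ (map f (g x)) _ ⟩
    sum (map f (g x)) + sum (map f (concatMap g xs))
      ≡⟨ cong (sum (map f (g x)) +_) (sum-concatMap f g xs) ⟩
    sum (map f (g x)) + sum (map (λ x → sum (map f (g x))) xs) ∎
    where open ≡-Reasoning

  #protected-gf : ∀ k → #protected k ≗ gf (#protectedIn k)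
  #protected-gf k n = begin
    length (protectedPairs k n)
      -- `protected?` is a `map′` of `k ≤? rank v`, so the two share their `does` definitionally.
      ≡⟨ length-filter-sum (λ (_ , v) → protected? k v) (pointedTrees n) ⟩
    sum (map (λ (_ , v) → if does (k ≤? rank v) then 1 else 0) (pointedTrees n))
      ≡⟨ cong sum (map-cong (λ (_ , v) → atLeast-≤? k (rank v)) (pointedTrees n)) ⟩
    sum (map atLeastRank (pointedTrees n))
      ≡⟨ sum-concatMap atLeastRank (λ T → map (T ,_) (vertices T)) (motzkinTrees n) ⟩
    sum (map (λ T → sum (map atLeastRank (map (T ,_) (vertices T)))) (motzkinTrees n))
      ≡⟨ cong sum (map-cong (λ T → cong sum (sym (map-∘ (vertices T)))) (motzkinTrees n)) ⟩
    gf (#protectedIn k) n ∎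
    where
    open ≡-Reasoning
    atLeastRank : ∃ Vertex → ℕ
    atLeastRank (_ , v) = atLeast k (rank v)

  -- Functional equations of the generating functions

  M : Series
  M = gf (λ _ → 1)

  R P : ℕ → Series
  R k = gf (rootProtected k)
  P k = gf (#protectedIn k)

  #trees-M : #trees ≗ M
  #trees-M n = go (motzkinTrees n)
    where
    go : ∀ (Ts : List MotzkinTree) → length Ts ≡ sum (map (λ _ → 1) Ts)
    go []       = refl
    go (_ ∷ Ts) = cong suc (go Ts)

  M-equation : M ≗ z (𝟙 ⊕ (M ⊕ M ⊛ M))
  M-equation n = trans (gf-decompose (λ _ → 1) _ _ (λ _ _ → refl) n)
    (z-cong (λ n → cong (_+ (M n + (M ⊛ M) n)) (*-identityˡ (𝟙 n))) n)

  -- A root has rank at least k + 1 exactly when it has children and all of them have rank at least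
  -- k; the single leaf has weight 0.
  R-suc : ∀ k → R (suc k) ≗ z (R k ⊕ R k ⊛ R k)
  R-suc k = gf-decompose (rootProtected (suc k)) _ _
    (λ L R → atLeast-⊓ k (rank {L} root) (rank {R} root))

  private
    -- Each weight lives on one shape of root, and the factors 1 let it meet the product condition
    -- of `gf-decompose` by `refl`.
    inUnary inLeft inRight : ℕ → MotzkinTree → ℕ
    inUnary k (unary T) = #protectedIn k T
    inUnary k _         = 0
    inLeft k (binary L R) = #protectedIn k L * 1
    inLeft k _            = 0
    inRight k (binary L R) = 1 * #protectedIn k R
    inRight k _            = 0

    #protectedIn-split : ∀ k T →
      #protectedIn k T ≡ rootProtected k T + (inUnary k T + (inLeft k T + inRight k T))
    #protectedIn-split k leaf = refl
    #protectedIn-split k (unary T) = cong (rootProtected k (unary T) +_)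
      (trans (cong sum (sym (map-∘ (vertices T)))) (sym (+-identityʳ _)))
    #protectedIn-split k (binary L R) = cong (rootProtected k (binary L R) +_) (begin
      sum (map f (map left (vertices L) ++ map right (vertices R)))
        ≡⟨ cong sum (map-++ f (map left (vertices L)) _) ⟩
      sum (map f (map left (vertices L)) ++ map f (map right (vertices R)))
        ≡⟨ sum-++ (map f (map left (vertices L))) _ ⟩
      sum (map f (map left (vertices L))) + sum (map f (map right (vertices R)))
        ≡⟨ cong₂ _+_ (cong sum (sym (map-∘ (vertices L)))) (cong sum (sym (map-∘ (vertices R)))) ⟩
      #protectedIn k L + #protectedIn k R
        ≡⟨ cong₂ _+_ (*-identityʳ (#protectedIn k L)) (*-identityˡ (#protectedIn k R)) ⟨
      #protectedIn k L * 1 + 1 * #protectedIn k R ∎)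
      where
      open ≡-Reasoning
      f : ∀ {T} → Vertex T → ℕ
      f v = atLeast k (rank v)

  gf-𝟘 : gf (λ _ → 0) ≗ 𝟘
  gf-𝟘 n = go (motzkinTrees n)
    where
    go : ∀ (Ts : List MotzkinTree) → sum (map (λ _ → 0) Ts) ≡ 0
    go []       = refl
    go (_ ∷ Ts) = go Ts

  -- A protected vertex is the root or lies below an only, left or right child; in the last two
  -- cases the other subtree is arbitrary and contributes a factor `M`.
  P-equation : ∀ k → P k ≗ R k ⊕ z (P k ⊕ (M ⊛ P k ⊕ M ⊛ P k))
  P-equation k n = begin
    P k n ≡⟨ gf-cong (#protectedIn-split k) n ⟩
    gf (λ T → rootProtected k T + (inUnary k T + (inLeft k T + inRight k T))) n
      ≡⟨ gf-+ (rootProtected k) _ n ⟩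
    R k n + gf (λ T → inUnary k T + (inLeft k T + inRight k T)) n
      ≡⟨ cong (R k n +_) (gf-+ (inUnary k) _ n) ⟩
    R k n + (gf (inUnary k) n + gf (λ T → inLeft k T + inRight k T) n)
      ≡⟨ cong (λ x → R k n + (gf (inUnary k) n + x)) (gf-+ (inLeft k) (inRight k) n) ⟩
    R k n + (gf (inUnary k) n + (gf (inLeft k) n + gf (inRight k) n))
      ≡⟨ cong (R k n +_) (assemble n) ⟩
    R k n + z (P k ⊕ (M ⊛ P k ⊕ M ⊛ P k)) n ∎
    where
    open ≡-Reasoning
    assemble : gf (inUnary k) ⊕ (gf (inLeft k) ⊕ gf (inRight k)) ≗ z (P k ⊕ (M ⊛ P k ⊕ M ⊛ P k))
    assemble n
      rewrite gf-decompose (inUnary k) (λ _ → 0) (λ _ → 0) (λ _ _ → refl) n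
            | gf-decompose (inLeft k) (#protectedIn k) (λ _ → 1) (λ _ _ → refl) n
            | gf-decompose (inRight k) (λ _ → 1) (#protectedIn k) (λ _ _ → refl) n = go n
      where
      go : ∀ n → z (0 · 𝟙 ⊕ (P k ⊕ gf (λ _ → 0) ⊛ gf (λ _ → 0))) n
               + (z (0 · 𝟙 ⊕ (gf (λ _ → 0) ⊕ P k ⊛ M)) n + z (0 · 𝟙 ⊕ (gf (λ _ → 0) ⊕ M ⊛ P k)) n)
               ≡ z (P k ⊕ (M ⊛ P k ⊕ M ⊛ P k)) n
      go zero    = refl
      go (suc n) rewrite gf-𝟘 n
                       | ⊛-cong {G = gf (λ _ → 0)} gf-𝟘 (λ _ → refl) n
                       | ⊛-zeroˡ (gf (λ _ → 0)) n
                       | ⊛-comm (P k) M n = cong (_+ ((M ⊛ P k) n + (M ⊛ P k) n)) (+-identityʳ (P k n))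

  -- Each of the `M n` trees contributes all of its n vertices. This plays the part of the identity
  -- P 0 = z M′.
  P₀ : ∀ n → P 0 n ≡ n * M n
  P₀ n = trans
    (go (motzkinTrees n) (λ T∈ → Equivalence.to (∈-motzkinTrees _) T∈))
    (cong (n *_) (#trees-M n))
    where
    ones : ∀ {T} (vs : List (Vertex T)) → sum (map (λ v → atLeast 0 (rank v)) vs) ≡ length vs
    ones []       = refl
    ones (_ ∷ vs) = cong suc (ones vs)
    go : ∀ Ts → (∀ {T} → T ∈ Ts → size T ≡ n) → sum (map (#protectedIn 0) Ts) ≡ n * length Ts
    go []       _     = sym (*-zeroʳ n)
    go (T ∷ Ts) sizes = trans
      (cong₂ _+_ (trans (ones (vertices T)) (sizes (here refl))) (go Ts (sizes ∘ there)))
      (sym (*-suc n (length Ts)))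

open GeneratingFunctions

-- The central trinomial coefficients and their growth

module Growth where
  open import Data.Nat.Base using (_+_; _*_; _≤_; NonZero)
  open import Data.Nat.Properties

  -- The shift makes coefficient i + 1 of the right-hand side depend only on coefficients up to i of
  -- the unknown, so strong induction determines the solution.
  guarded-unique : ∀ H (Ψ : Series → Series) →
                   (∀ {F G} n → (∀ {i} → i ≤ n → F i ≡ G i) → Ψ F n ≡ Ψ G n) →
                   ∀ {F G} → F ≗ H ⊕ z (Ψ F) → G ≗ H ⊕ z (Ψ G) → F ≗ G
  guarded-unique H Ψ Ψ-cong {F} {G} F-eq G-eq n = go n ≤-refl
    where
    open ≡-Reasoning
    go : ∀ n {i} → i ≤ n → F i ≡ G i
    go _       {zero}  _         = trans (F-eq 0) (sym (G-eq 0))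
    go (suc n) {suc i} (s≤s i≤n) = begin
      F (suc i)             ≡⟨ F-eq (suc i) ⟩
      H (suc i) + Ψ F i     ≡⟨ cong (H (suc i) +_) (Ψ-cong i (λ j≤i → go n (≤-trans j≤i i≤n))) ⟩
      H (suc i) + Ψ G i     ≡⟨ G-eq (suc i) ⟨
      G (suc i)             ∎

  -- The series 1/(1 - z - 2zM) without an inversion: it satisfies U = 1 + zU + 2zMU, and here `P 0`
  -- takes the place of MU. `P₀-M⊛U` justifies the substitution.
  U : Series
  U zero    = 1
  U (suc n) = U n + (P 0 n + P 0 n)

  U-equation : U ≗ 𝟙 ⊕ z (U ⊕ (P 0 ⊕ P 0))
  U-equation zero    = refl
  U-equation (suc n) = refl

  ⊛-identityʳ : ∀ F → F ⊛ 𝟙 ≗ F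
  ⊛-identityʳ F n = trans (⊛-comm F 𝟙 n) (⊛-identityˡ F n)

  ⊛-U : ∀ F → F ⊛ U ≗ F ⊕ z (F ⊛ U ⊕ (F ⊛ P 0 ⊕ F ⊛ P 0))
  ⊛-U F n = begin
    (F ⊛ U) n
      ≡⟨ ⊛-cong {F} (λ _ → refl) U-equation n ⟩
    (F ⊛ (𝟙 ⊕ z (U ⊕ (P 0 ⊕ P 0)))) n
      ≡⟨ ⊛-distribˡ-⊕ F 𝟙 _ n ⟩
    (F ⊛ 𝟙) n + (F ⊛ z (U ⊕ (P 0 ⊕ P 0))) n
      ≡⟨ cong₂ _+_ (⊛-identityʳ F n) (z-⊛ʳ F (U ⊕ (P 0 ⊕ P 0)) n) ⟩
    F n + z (F ⊛ (U ⊕ (P 0 ⊕ P 0))) n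
      ≡⟨ cong (F n +_) (z-cong (λ n → trans (⊛-distribˡ-⊕ F U (P 0 ⊕ P 0) n)
                                     (cong ((F ⊛ U) n +_) (⊛-distribˡ-⊕ F (P 0) (P 0) n))) n) ⟩
    F n + z (F ⊛ U ⊕ (F ⊛ P 0 ⊕ F ⊛ P 0)) n ∎
    where open ≡-Reasoning

  -- Both sides solve X = M + z(X + 2 M P 0) with the term M P 0 held fixed; `R 0` unfolds to `M`.
  P₀-M⊛U : P 0 ≗ M ⊛ U
  P₀-M⊛U = guarded-unique M (λ F → F ⊕ (M ⊛ P 0 ⊕ M ⊛ P 0))
    (λ n F≗G → cong (_+ ((M ⊛ P 0) n + (M ⊛ P 0) n)) (F≗G ≤-refl))
    (P-equation 0) (⊛-U M)

  ⊛-swap : ∀ F G H → F ⊛ (G ⊛ H) ≗ G ⊛ (F ⊛ H)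
  ⊛-swap F G H n = begin
    (F ⊛ (G ⊛ H)) n  ≡⟨ ⊛-assoc F G H n ⟨
    (F ⊛ G ⊛ H) n    ≡⟨ ⊛-cong {G = H} (⊛-comm F G) (λ _ → refl) n ⟩
    (G ⊛ F ⊛ H) n    ≡⟨ ⊛-assoc G F H n ⟩
    (G ⊛ (F ⊛ H)) n  ∎
    where open ≡-Reasoning

  -- Both sides solve X = R k + z(X + 2MX). For the product this uses R k P 0 = M (R k U), a
  -- consequence of P 0 = MU.
  P-R⊛U : ∀ k → P k ≗ R k ⊛ U
  P-R⊛U k = guarded-unique (R k) (λ F → F ⊕ (M ⊛ F ⊕ M ⊛ F))
    (λ n F≗G → let M⊛F≗M⊛G = ⊛-cong-≤ {M} n (λ _ → refl) F≗G in
      cong₂ _+_ (F≗G ≤-refl) (cong₂ _+_ M⊛F≗M⊛G M⊛F≗M⊛G))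
    (P-equation k)
    (λ n → trans (⊛-U (R k) n)
      (cong (R k n +_) (z-cong (⊕-cong {R k ⊛ U} (λ _ → refl) (⊕-cong R⊛P₀ R⊛P₀)) n)))
    where
    R⊛P₀ : R k ⊛ P 0 ≗ M ⊛ (R k ⊛ U)
    R⊛P₀ n = trans (⊛-cong {R k} (λ _ → refl) P₀-M⊛U n) (⊛-swap (R k) M U n)

  -- The equation of `M` multiplied by `U` gives t′ = u + t + y, and the equation of `P 0` gives t′
  -- = m′ + t + 2y. Comparing twice the first with the second eliminates the convolution y.
  P₀-suc : ∀ n → P 0 (suc n) + M (suc n) ≡ 2 * U n + P 0 n
  P₀-suc n = +-cancelʳ-≡ (t + (y + y)) (t′ + m′) (2 * u + t) (begin
    t′ + m′ + (t + (y + y))        ≡⟨ +-assoc t′ m′ _ ⟩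
    t′ + (m′ + (t + (y + y)))      ≡⟨ cong (t′ +_) (P-equation 0 (suc n)) ⟨
    t′ + t′                        ≡⟨ cong₂ _+_ t′-eq t′-eq ⟩
    u + (t + y) + (u + (t + y))    ≡⟨ lemma u t y ⟩
    2 * u + t + (t + (y + y))      ∎)
    where
    open ≡-Reasoning
    u = U n
    t = P 0 n
    t′ = P 0 (suc n)
    m′ = M (suc n)
    y = (M ⊛ P 0) n
    lemma : ∀ u t y → u + (t + y) + (u + (t + y)) ≡ 2 * u + t + (t + (y + y))
    lemma = solve-∀
    t′-eq : t′ ≡ u + (t + y)
    t′-eq = begin
      P 0 (suc n)                                 ≡⟨ P₀-M⊛U (suc n) ⟩
      (M ⊛ U) (suc n)                             ≡⟨ ⊛-cong {G = U} M-equation (λ _ → refl) (suc n) ⟩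
      ((𝟙 ⊕ (M ⊕ M ⊛ M)) ⊛ U) n                   ≡⟨ ⊛-distribʳ-⊕ U 𝟙 (M ⊕ M ⊛ M) n ⟩
      (𝟙 ⊛ U) n + ((M ⊕ M ⊛ M) ⊛ U) n
        ≡⟨ cong₂ _+_ (⊛-identityˡ U n) (⊛-distribʳ-⊕ U M (M ⊛ M) n) ⟩
      U n + ((M ⊛ U) n + (M ⊛ M ⊛ U) n)
        ≡⟨ cong (λ x → U n + ((M ⊛ U) n + x)) (⊛-assoc M M U n) ⟩
      U n + ((M ⊛ U) n + (M ⊛ (M ⊛ U)) n)
        ≡⟨ cong (U n +_) (cong₂ _+_ (P₀-M⊛U n) (⊛-cong {M} (λ _ → refl) P₀-M⊛U n)) ⟨
      U n + (P 0 n + (M ⊛ P 0) n)                 ∎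

  -- Multiplying `P₀-suc` by n + 1 turns its `M` term into P 0 (n + 1), by `P₀`. As 2 P 0 n = U (n +
  -- 1) - U n, only `U` remains.
  U-recurrence : ∀ n → (2 + n) * U (2 + n) ≡ (3 + 2 * n) * U (1 + n) + 3 * (1 + n) * U n
  U-recurrence n = begin
    (2 + n) * (U (1 + n) + (t′ + t′))
      ≡⟨ expand n (U (1 + n)) t′ ⟩
    (2 + n) * U (1 + n) + 2 * ((1 + n) * t′ + t′)
      ≡⟨ cong (λ x → (2 + n) * U (1 + n) + 2 * ((1 + n) * t′ + x)) (P₀ (1 + n)) ⟩
    (2 + n) * U (1 + n) + 2 * ((1 + n) * t′ + (1 + n) * m′)
      ≡⟨ cong (λ x → (2 + n) * U (1 + n) + 2 * x) (*-distribˡ-+ (1 + n) t′ m′) ⟨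
    (2 + n) * U (1 + n) + 2 * ((1 + n) * (t′ + m′))
      ≡⟨ cong (λ x → (2 + n) * U (1 + n) + 2 * ((1 + n) * x)) (P₀-suc n) ⟩
    (2 + n) * U (1 + n) + 2 * ((1 + n) * (2 * U n + P 0 n))
      ≡⟨ collect n (U n) (P 0 n) ⟩
    (3 + 2 * n) * U (1 + n) + 3 * (1 + n) * U n                ∎
    where
    open ≡-Reasoning
    t′ = P 0 (suc n)
    m′ = M (suc n)
    expand : ∀ n u t → (2 + n) * (u + (t + t)) ≡ (2 + n) * u + 2 * ((1 + n) * t + t)
    expand = solve-∀
    collect : ∀ n u t → (2 + n) * (u + (t + t)) + 2 * ((1 + n) * (2 * u + t))
                      ≡ (3 + 2 * n) * (u + (t + t)) + 3 * (1 + n) * u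
    collect = solve-∀

  -- A joint induction through the recurrence: the upper bound at n + 1 uses the lower bound at n,
  -- and conversely. It makes the ratio of consecutive terms 3 + O(1/n).
  U-bounds : ∀ n → U (1 + n) ≤ 3 * U n × 3 * (1 + n) * U n ≤ (3 + n) * U (1 + n)
  U-bounds zero    = s≤s z≤n , s≤s (s≤s (s≤s z≤n))
  U-bounds (suc n) with upper , lower ← U-bounds n =
    *-cancelˡ-≤ (2 + n) upper′ , *-cancelˡ-≤ (2 + n) lower′
    where
    open ≤-Reasoning
    u = U n
    u₁ = U (1 + n)
    u₂ = U (2 + n)
    upper′ : (2 + n) * u₂ ≤ (2 + n) * (3 * u₁)
    upper′ = begin
      (2 + n) * u₂                          ≡⟨ U-recurrence n ⟩
      (3 + 2 * n) * u₁ + 3 * (1 + n) * u    ≤⟨ +-monoʳ-≤ ((3 + 2 * n) * u₁) lower ⟩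
      (3 + 2 * n) * u₁ + (3 + n) * u₁       ≡⟨ lemma n u₁ ⟩
      (2 + n) * (3 * u₁)                    ∎
      where
      lemma : ∀ n u → (3 + 2 * n) * u + (3 + n) * u ≡ (2 + n) * (3 * u)
      lemma = solve-∀
    lower′ : (2 + n) * (3 * (2 + n) * u₁) ≤ (2 + n) * ((4 + n) * u₂)
    lower′ = begin
      (2 + n) * (3 * (2 + n) * u₁)
        -- The slack comes from (4 + n)(4 + 3n) = 3(2 + n)² + (4 + 4n).
        ≤⟨ m≤m+n _ ((4 + 4 * n) * u₁) ⟩
      (2 + n) * (3 * (2 + n) * u₁) + (4 + 4 * n) * u₁
        ≡⟨ lemma₁ n u₁ ⟩
      (4 + n) * ((3 + 2 * n) * u₁ + (1 + n) * u₁)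
        ≤⟨ *-monoʳ-≤ (4 + n) (+-monoʳ-≤ ((3 + 2 * n) * u₁) (*-monoʳ-≤ (1 + n) upper)) ⟩
      (4 + n) * ((3 + 2 * n) * u₁ + (1 + n) * (3 * u))
        ≡⟨ lemma₂ n u u₁ ⟩
      (4 + n) * ((3 + 2 * n) * u₁ + 3 * (1 + n) * u)
        ≡⟨ cong ((4 + n) *_) (U-recurrence n) ⟨
      (4 + n) * ((2 + n) * u₂)
        ≡⟨ lemma₃ n u₂ ⟩
      (2 + n) * ((4 + n) * u₂)                                  ∎
      where
      lemma₁ : ∀ n u → (2 + n) * (3 * (2 + n) * u) + (4 + 4 * n) * u
                     ≡ (4 + n) * ((3 + 2 * n) * u + (1 + n) * u)
      lemma₁ = solve-∀
      lemma₂ : ∀ n u v → (4 + n) * ((3 + 2 * n) * v + (1 + n) * (3 * u))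
                       ≡ (4 + n) * ((3 + 2 * n) * v + 3 * (1 + n) * u)
      lemma₂ = solve-∀
      lemma₃ : ∀ n u → (4 + n) * ((2 + n) * u) ≡ (2 + n) * ((4 + n) * u)
      lemma₃ = solve-∀

  -- The upper ratio bound again, since U (n + 1) = U n + 2 P 0 n.
  P₀≤U : ∀ n → P 0 n ≤ U n
  P₀≤U n = *-cancelˡ-≤ 2 (+-cancelˡ-≤ (U n) (2 * P 0 n) (2 * U n)
    (subst₂ _≤_ (lemma (U n) (P 0 n)) refl (proj₁ (U-bounds n))))
    where
    lemma : ∀ u t → u + (t + t) ≡ u + 2 * t
    lemma = solve-∀

  -- The lower ratio bound with U (n + 1) expanded, except for a remainder 2 U (n + 1) that is at
  -- most 6 U n. With `P₀≤U` it gives P 0 n / U n = 1 + O(1/n).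
  U-P₀-gap : ∀ n → (1 + n) * U n ≤ (1 + n) * P 0 n + 3 * U n
  U-P₀-gap n = *-cancelˡ-≤ 2 (+-cancelˡ-≤ ((1 + n) * u) _ _ (begin
    (1 + n) * u + 2 * ((1 + n) * u)                            ≡⟨ lemma₁ n u ⟩
    3 * (1 + n) * u                                            ≤⟨ proj₂ (U-bounds n) ⟩
    (3 + n) * U (1 + n)                                        ≡⟨ lemma₂ n u t ⟩
    (1 + n) * u + 2 * ((1 + n) * t) + 2 * U (1 + n)
      ≤⟨ +-monoʳ-≤ ((1 + n) * u + 2 * ((1 + n) * t)) (*-monoʳ-≤ 2 (proj₁ (U-bounds n))) ⟩
    (1 + n) * u + 2 * ((1 + n) * t) + 2 * (3 * u)              ≡⟨ lemma₃ n u t ⟩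
    (1 + n) * u + 2 * ((1 + n) * t + 3 * u)                    ∎))
    where
    open ≤-Reasoning
    u = U n
    t = P 0 n
    lemma₁ : ∀ n u → (1 + n) * u + 2 * ((1 + n) * u) ≡ 3 * (1 + n) * u
    lemma₁ = solve-∀
    lemma₂ : ∀ n u t → (3 + n) * (u + (t + t)) ≡ (1 + n) * u + 2 * ((1 + n) * t) + 2 * (u + (t + t))
    lemma₂ = solve-∀
    lemma₃ : ∀ n u t → (1 + n) * u + 2 * ((1 + n) * t) + 2 * (3 * u)
                     ≡ (1 + n) * u + 2 * ((1 + n) * t + 3 * u)
    lemma₃ = solve-∀

  -- Errors are measured against `U` while proportions divide by `P 0`; this converts one into the
  -- other. It fails at index 0, where `P 0` vanishes.
  U≤4P₀ : ∀ n .{{_ : NonZero n}} → U n ≤ 4 * P 0 n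
  U≤4P₀ (suc n) = *-cancelˡ-≤ (2 * (1 + n)) (+-cancelˡ-≤ ((4 + n) * u) _ _ (begin
    (4 + n) * u + 2 * (1 + n) * u                   ≡⟨ lemma₁ n u ⟩
    3 * (2 + n) * u                                 ≤⟨ proj₂ (U-bounds (suc n)) ⟩
    -- The added 6nt raises the coefficient 2(4 + n) of t to 8(1 + n).
    (4 + n) * (u + (t + t))                         ≤⟨ m≤m+n _ (6 * n * t) ⟩
    (4 + n) * (u + (t + t)) + 6 * n * t             ≡⟨ lemma₂ n u t ⟩
    (4 + n) * u + 2 * (1 + n) * (4 * t)             ∎))
    where
    open ≤-Reasoning
    u = U (suc n)
    t = P 0 (suc n)
    lemma₁ : ∀ n u → (4 + n) * u + 2 * (1 + n) * u ≡ 3 * (2 + n) * u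
    lemma₁ = solve-∀
    lemma₂ : ∀ n u t → (4 + n) * (u + (t + t)) + 6 * n * t ≡ (4 + n) * u + 2 * (1 + n) * (4 * t)
    lemma₂ = solve-∀

  U-ratio-gap : ∀ n → (2 + n) * (3 * U n) ≤ (2 + n) * U (1 + n) + 4 * U (1 + n)
  U-ratio-gap n = begin
    (2 + n) * (3 * U n)                      ≡⟨ lemma₁ n (U n) ⟩
    3 * (1 + n) * U n + 3 * U n
      ≤⟨ +-mono-≤ (proj₂ (U-bounds n)) (*-monoʳ-≤ 3 (m≤m+n (U n) _)) ⟩
    (3 + n) * U (1 + n) + 3 * U (1 + n)      ≡⟨ lemma₂ n (U (1 + n)) ⟩
    (2 + n) * U (1 + n) + 4 * U (1 + n)      ∎
    where
    open ≤-Reasoning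
    lemma₁ : ∀ n u → (2 + n) * (3 * u) ≡ 3 * (1 + n) * u + 3 * u
    lemma₁ = solve-∀
    lemma₂ : ∀ n u → (3 + n) * u + 3 * u ≡ (2 + n) * u + 4 * u
    lemma₂ = solve-∀

open Growth

-- Natural numbers inside the rationals

open import Data.Integer.Base as ℤ using (+_; +[1+_])
open import Data.Rational.Base
  using (ℚ; mkℚ; toℚᵘ; 0ℚ; 1ℚ; _+_; _*_; _-_; -_; _/_; ∣_∣; _≤_; _<_; *≤*; *<*;
         Positive; nonNegative; positive; ↥_)
import Data.Nat.Coprimality as Coprime
import Data.Integer.Properties as ℤ
open import Data.Rational.Properties
open import Data.Rational.Solver using (module +-*-Solver)
import Data.Rational.Unnormalised.Base as ℚᵘ
import Data.Rational.Unnormalised.Properties as ℚᵘ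
open +-*-Solver using (solve; con; _:=_; _:+_; _:*_; _:-_; :-_)

-- Given in lowest terms instead of as `+ n / 1`, so that numerator and denominator are visible
-- without evaluating a gcd.
ι : ℕ → ℚ
ι n = mkℚ (+ n) 0 (Coprime.sym (Coprime.1-coprimeTo n))

ι-+ : ∀ m n → ι (m ℕ.+ n) ≡ ι m + ι n
ι-+ m n = toℚᵘ-injective (ℚᵘ.≃-trans
  (ℚᵘ.≃-reflexive (cong (λ i → ℚᵘ.mkℚᵘ i 0)
    (trans (ℤ.pos-+ m n) (cong₂ ℤ._+_ (sym (ℤ.*-identityʳ (+ m))) (sym (ℤ.*-identityʳ (+ n)))))))
  (ℚᵘ.≃-sym (toℚᵘ-homo-+ (ι m) (ι n))))

ι-* : ∀ m n → ι (m ℕ.* n) ≡ ι m * ι n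
ι-* m n = toℚᵘ-injective (ℚᵘ.≃-trans
  (ℚᵘ.≃-reflexive (cong (λ i → ℚᵘ.mkℚᵘ i 0) (ℤ.pos-* m n)))
  (ℚᵘ.≃-sym (toℚᵘ-homo-* (ι m) (ι n))))

ι-mono-≤ : ∀ {m n} → m ℕ.≤ n → ι m ≤ ι n
ι-mono-≤ m≤n = *≤* (ℤ.*-monoʳ-≤-nonNeg (+ 1) (ℤ.+≤+ m≤n))

/-*-ι : ∀ p t .{{_ : ℕ.NonZero t}} → (+ p / t) * ι t ≡ ι p
/-*-ι p t@(suc t-1) = toℚᵘ-injective (ℚᵘ.≃-trans (toℚᵘ-homo-* (+ p / t) (ι t))
  (ℚᵘ.≃-trans (ℚᵘ.*-congʳ {toℚᵘ (ι t)} (toℚᵘ-fromℚᵘ (ℚᵘ.mkℚᵘ (+ p) t-1)))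
    (ℚᵘ.*≡* (trans (ℤ.*-identityʳ _) (cong (λ d → + p ℤ.* + d) (sym (ℕ.*-identityʳ t)))))))

<-ι : ∀ p → p < ι (suc ℤ.∣ ↥ p ∣)
<-ι (mkℚ (+ a) d _) = *<* (ℤ.<-≤-trans
  (ℤ.*-monoʳ-<-pos (+ 1) (ℤ.+<+ (ℕ.n<1+n a)))
  (ℤ.*-monoˡ-≤-nonNeg (+ suc a) (ℤ.+≤+ (s≤s (z≤n {d})))))
<-ι (mkℚ ℤ.-[1+ a ] d _) = *<* ℤ.-<+

archimedean : ∀ E ε .{{_ : Positive ε}} → ∃[ N ] E < ε * ι N
-- The factor d + 1 of the witness clears the denominator of ε = (e + 1)/(d + 1), leaving (e + 1) y
-- ≥ y > E.
archimedean E ε@(mkℚ +[1+ e ] d _) = y ℕ.* suc d , (begin-strict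
  E                        <⟨ <-ι E ⟩
  ι y                      ≡⟨ cong ι (ℕ.*-identityˡ y) ⟨
  ι (1 ℕ.* y)              ≤⟨ ι-mono-≤ (ℕ.*-monoˡ-≤ y (s≤s (z≤n {e}))) ⟩
  ι (suc e ℕ.* y)          ≡⟨ ι-* (suc e) y ⟩
  ι (suc e) * ι y          ≡⟨ cong (_* ι y) (/-*-ι (suc e) (suc d)) ⟨
  (+[1+ e ] / suc d) * ι (suc d) * ι y   ≡⟨ cong (λ x → x * ι (suc d) * ι y) (↥p/↧p≡p ε) ⟩
  ε * ι (suc d) * ι y      ≡⟨ *-assoc ε (ι (suc d)) (ι y) ⟩
  ε * (ι (suc d) * ι y)    ≡⟨ cong (ε *_) (*-comm (ι (suc d)) (ι y)) ⟩
  ε * (ι y * ι (suc d))    ≡⟨ cong (ε *_) (ι-* y (suc d)) ⟨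
  ε * ι (y ℕ.* suc d)      ∎)
  where
  open ≤-Reasoning
  y = suc ℤ.∣ ↥ E ∣

-- Asymptotics relative to U with explicit O(1/n) errors

⅓ : ℚ
⅓ = + 1 / 3

-- The estimate |a| ≤ C U n / (n + 1), cleared of division. Non-negativity of C is carried along so
-- that `U n` can be replaced by larger quantities.
record Small (n : ℕ) (C a : ℚ) : Set where
  constructor small
  field
    nonNeg : 0ℚ ≤ C
    bound  : ι (suc n) * ∣ a ∣ ≤ C * ι (U n)

small-+ : ∀ {n C D a b} → Small n C a → Small n D b → Small n (C + D) (a + b)
small-+ {n} {C} {D} {a} {b} (small 0≤C a≤) (small 0≤D b≤) = small (+-mono-≤ 0≤C 0≤D) (begin
  ι (suc n) * ∣ a + b ∣                     ≤⟨ *-monoˡ-≤-nonNeg (ι (suc n)) (∣p+q∣≤∣p∣+∣q∣ a b) ⟩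
  ι (suc n) * (∣ a ∣ + ∣ b ∣)               ≡⟨ *-distribˡ-+ (ι (suc n)) ∣ a ∣ ∣ b ∣ ⟩
  ι (suc n) * ∣ a ∣ + ι (suc n) * ∣ b ∣     ≤⟨ +-mono-≤ a≤ b≤ ⟩
  C * ι (U n) + D * ι (U n)                 ≡⟨ *-distribʳ-+ (ι (U n)) C D ⟨
  (C + D) * ι (U n)                         ∎)
  where open ≤-Reasoning

small-* : ∀ c {n C a} → Small n C a → Small n (∣ c ∣ * C) (c * a)
small-* c {n} {C} {a} (small 0≤C a≤) = small
  (subst (_≤ ∣ c ∣ * C) (*-zeroʳ ∣ c ∣) (*-monoˡ-≤-nonNeg ∣ c ∣ {{∣-∣-nonNeg c}} 0≤C)) (begin
  ι (suc n) * ∣ c * a ∣             ≡⟨ cong (ι (suc n) *_) (∣p*q∣≡∣p∣*∣q∣ c a) ⟩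
  ι (suc n) * (∣ c ∣ * ∣ a ∣)
    ≡⟨ solve 3 (λ N c a → N :* (c :* a) := c :* (N :* a)) refl (ι (suc n)) ∣ c ∣ ∣ a ∣ ⟩
  ∣ c ∣ * (ι (suc n) * ∣ a ∣)       ≤⟨ *-monoˡ-≤-nonNeg ∣ c ∣ {{∣-∣-nonNeg c}} a≤ ⟩
  ∣ c ∣ * (C * ι (U n))             ≡⟨ *-assoc ∣ c ∣ C (ι (U n)) ⟨
  (∣ c ∣ * C) * ι (U n)             ∎)
  where open ≤-Reasoning

-- As a ≤ b, the absolute value is the natural number b ∸ a, so the estimate reduces to one in ℕ.
small-gap : ∀ n c {a b} → a ℕ.≤ b → suc n ℕ.* b ℕ.≤ suc n ℕ.* a ℕ.+ c ℕ.* U n →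
            Small n (ι c) (ι b - ι a)
small-gap n c {a} {b} a≤b gap = small (ι-mono-≤ (z≤n {c})) (begin
  ι (suc n) * ∣ ι b - ι a ∣     ≡⟨ cong (λ x → ι (suc n) * ∣ x ∣) {y = ι d} b-a≡d ⟩
  ι (suc n) * ι d               ≡⟨ ι-* (suc n) d ⟨
  ι (suc n ℕ.* d)               ≤⟨ ι-mono-≤ n*d≤c*u ⟩
  ι (c ℕ.* U n)                 ≡⟨ ι-* c (U n) ⟩
  ι c * ι (U n)                 ∎)
  where
  open ≤-Reasoning
  d = b ∸ a
  b-a≡d : ι b - ι a ≡ ι d
  b-a≡d = trans
    (cong (_- ι a) (trans (cong ι (sym (ℕ.m+[n∸m]≡n a≤b))) (ι-+ a d)))
    (solve 2 (λ a d → (a :+ d) :- a := d) refl (ι a) (ι d))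
  n*d≤c*u : suc n ℕ.* d ℕ.≤ c ℕ.* U n
  n*d≤c*u = ℕ.+-cancelˡ-≤ (suc n ℕ.* a) _ _ (ℕ.≤-trans (ℕ.≤-reflexive
    (trans (sym (ℕ.*-distribˡ-+ (suc n) a d)) (cong (suc n ℕ.*_) (ℕ.m+[n∸m]≡n a≤b)))) gap)

-- The factor 2 pays for n + 2 ≤ 2(n + 1), while `U` does not decrease.
small-suc : ∀ {n C a} → Small n C a → Small (suc n) (ι 2 * C) a
small-suc {n} {C} {a} (small 0≤C a≤) = small
  (subst (_≤ ι 2 * C) (*-zeroʳ (ι 2)) (*-monoˡ-≤-nonNeg (ι 2) 0≤C)) (begin
  ι (2 ℕ.+ n) * ∣ a ∣
    ≤⟨ *-monoʳ-≤-nonNeg ∣ a ∣ {{∣-∣-nonNeg a}}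
         (ι-mono-≤ (ℕ.+-mono-≤ (s≤s (z≤n {n})) (ℕ.m≤m+n (suc n) 0))) ⟩
  ι (2 ℕ.* suc n) * ∣ a ∣
    ≡⟨ cong (_* ∣ a ∣) (ι-* 2 (suc n)) ⟩
  ι 2 * ι (suc n) * ∣ a ∣
    ≡⟨ *-assoc (ι 2) (ι (suc n)) ∣ a ∣ ⟩
  ι 2 * (ι (suc n) * ∣ a ∣)
    ≤⟨ *-monoˡ-≤-nonNeg (ι 2) a≤ ⟩
  ι 2 * (C * ι (U n))
    ≤⟨ *-monoˡ-≤-nonNeg (ι 2) (*-monoˡ-≤-nonNeg C {{nonNegative 0≤C}}
         (ι-mono-≤ (ℕ.m≤m+n (U n) _))) ⟩
  ι 2 * (C * ι (U (suc n)))
    ≡⟨ *-assoc (ι 2) C (ι (U (suc n))) ⟨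
  ι 2 * C * ι (U (suc n))       ∎)
  where open ≤-Reasoning

infix 4 _~_

-- F n / U n tends to v at rate O(1/n).
record _~_ (F : Series) (v : ℚ) : Set where
  constructor within
  field
    {rate} : ℚ
    near   : ∀ n → Small n rate (ι (F n) - v * ι (U n))

~-cong : ∀ {F G v} → F ≗ G → F ~ v → G ~ v
~-cong {v = v} F≗G (within F~v) = within λ n →
  subst (λ x → Small n _ (ι x - v * ι (U n))) (F≗G n) (F~v n)

~-⊕ : ∀ {F G v w} → F ~ v → G ~ w → F ⊕ G ~ v + w
~-⊕ {F} {G} {v} {w} (within F~v) (within G~w) =
  within λ n → subst (Small n _) (eq n) (small-+ (F~v n) (G~w n))
  where
  open ≡-Reasoning
  eq : ∀ n → (ι (F n) - v * ι (U n)) + (ι (G n) - w * ι (U n)) ≡ ι (F n ℕ.+ G n) - (v + w) * ι (U n)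
  eq n = begin
    (ι (F n) - v * ι (U n)) + (ι (G n) - w * ι (U n))
      ≡⟨ solve 5 (λ f g v w u → (f :- v :* u) :+ (g :- w :* u) := (f :+ g) :- (v :+ w) :* u) refl
           (ι (F n)) (ι (G n)) v w (ι (U n)) ⟩
    (ι (F n) + ι (G n)) - (v + w) * ι (U n)
      ≡⟨ cong (_- (v + w) * ι (U n)) (ι-+ (F n) (G n)) ⟨
    ι (F n ℕ.+ G n) - (v + w) * ι (U n) ∎

-- Coefficients are natural numbers, so a difference of series enters as the summand that completes
-- `G` to `F`.
~-cancel : ∀ {F G H v w} → F ≗ G ⊕ H → F ~ v → G ~ w → H ~ v - w
~-cancel {F} {G} {H} {v} {w} F≗G⊕H (within F~v) (within G~w) =
  within λ n → subst (Small n _) (eq n) (small-+ (F~v n) (small-* (- 1ℚ) (G~w n)))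
  where
  open ≡-Reasoning
  eq : ∀ n → (ι (F n) - v * ι (U n)) + - 1ℚ * (ι (G n) - w * ι (U n)) ≡ ι (H n) - (v - w) * ι (U n)
  eq n = begin
    (ι (F n) - v * ι (U n)) + - 1ℚ * (ι (G n) - w * ι (U n))
      ≡⟨ cong (λ f → (f - v * ι (U n)) + - 1ℚ * (ι (G n) - w * ι (U n)))
           (trans (cong ι (F≗G⊕H n)) (ι-+ (G n) (H n))) ⟩
    ((ι (G n) + ι (H n)) - v * ι (U n)) + - 1ℚ * (ι (G n) - w * ι (U n))
      ≡⟨ solve 5 (λ g h v w u → ((g :+ h) :- v :* u) :+ con (- 1ℚ) :* (g :- w :* u) := h :- (v :- w) :* u)
           refl
           (ι (G n)) (ι (H n)) v w (ι (U n)) ⟩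
    ι (H n) - (v - w) * ι (U n) ∎

U~1 : U ~ 1ℚ
U~1 = within λ n → subst (Small n 0ℚ) (solve 1 (λ u → con 0ℚ := u :- con 1ℚ :* u) refl (ι (U n)))
  (small ≤-refl (≤-reflexive (trans (*-zeroʳ (ι (suc n))) (sym (*-zeroˡ (ι (U n)))))))

P₀~1 : P 0 ~ 1ℚ
P₀~1 = within λ n → subst (Small n _)
  (solve 2 (λ t u → con (- 1ℚ) :* (u :- t) := t :- con 1ℚ :* u) refl (ι (P 0 n)) (ι (U n)))
  (small-* (- 1ℚ) (small-gap n 3 (P₀≤U n) (U-P₀-gap n)))

U-ratio : ∀ n → Small (suc n) (ι 4) (ι 3 * ι (U n) - ι (U (suc n)))
U-ratio n = subst (λ x → Small (suc n) (ι 4) (x - ι (U (suc n)))) (ι-* 3 (U n))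
  (small-gap (suc n) 4 (proj₁ (U-bounds n)) (U-ratio-gap n))

-- At index n + 1 the error is (F n - v U n) + (v/3)(3 U n - U (n + 1)): the error of `F` one index
-- earlier plus a multiple of the ratio gap.
~-z : ∀ {F v} → F ~ v → z F ~ ⅓ * v
~-z {F} {v} (within {C} F~v) = within bounds
  where
  bounds : ∀ n → Small n (ι 2 * C + ∣ ⅓ * v ∣ * ι 4) (ι (z F n) - ⅓ * v * ι (U n))
  bounds (suc n) = subst (Small (suc n) _)
    (solve 4 (λ f v u u′ → (f :- v :* u) :+ con ⅓ :* v :* (con (ι 3) :* u :- u′) := f :- con ⅓ :* v :* u′)
      refl
      (ι (F n)) v (ι (U n)) (ι (U (suc n))))
    (small-+ (small-suc (F~v n)) (small-* (⅓ * v) (U-ratio n)))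
  -- Here the error is -v/3, split as 0 + (v/3)(-1) to fit the same rate as in the successor case.
  bounds zero = subst (Small 0 _)
    (solve 1 (λ v → con 0ℚ :+ con ⅓ :* v :* con (- 1ℚ) := con 0ℚ :- con ⅓ :* v :* con 1ℚ) refl v)
    (small-+
      (small 0≤2C (subst (0ℚ ≤_) (sym (*-identityʳ (ι 2 * C))) 0≤2C))
      (small-* (⅓ * v) {C = ι 4} (small (ι-mono-≤ (z≤n {4})) (ι-mono-≤ {1} {4} (s≤s z≤n)))))
    where
    0≤2C = Small.nonNeg (small-suc (F~v 0))

-- Evaluation at the singularity

-- F = A(z) + B(z) M for polynomials A and B, and v = A(1/3) + B(1/3): the value
-- at the singularity z = 1/3, where M = 1.
data Evaluates : Series → ℚ → Set where
  one     : Evaluates 𝟙 1ℚ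
  motzkin : Evaluates M 1ℚ
  shift   : ∀ {F v} → Evaluates F v → Evaluates (z F) (⅓ * v)
  plus    : ∀ {F G v w} → Evaluates F v → Evaluates G w → Evaluates (F ⊕ G) (v + w)
  minus   : ∀ {F G H v w} → F ≗ G ⊕ H → Evaluates F v → Evaluates G w → Evaluates H (v - w)
  resp-≗    : ∀ {F G v w} → F ≗ G → v ≡ w → Evaluates F v → Evaluates G w

module _ {K : Series} {κ : ℚ}
  (𝟙⊛ : Evaluates (z (𝟙 ⊛ K)) (⅓ * (1ℚ * κ))) (M⊛ : Evaluates (z (M ⊛ K)) (⅓ * (1ℚ * κ))) where

  -- Multiplication by `K` is linear and commutes with shifts, so the generators 1 and `M` decide.
  -- The outer `z` is kept because the equation of `M` reduces zM², not M², to the form A + BM.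
  evaluates-z⊛-extend : ∀ {F v} → Evaluates F v → Evaluates (z (F ⊛ K)) (⅓ * (v * κ))
  evaluates-z⊛-extend one = 𝟙⊛
  evaluates-z⊛-extend motzkin = M⊛
  evaluates-z⊛-extend (shift {F} {v} f) = resp-≗
    (z-cong (λ n → sym (z-⊛ˡ F K n)))
    (cong (⅓ *_) (sym (*-assoc ⅓ v κ)))
    (shift (evaluates-z⊛-extend f))
  evaluates-z⊛-extend (plus {F} {G} {v} {w} f g) = resp-≗
    (λ n → sym (trans (z-cong (⊛-distribʳ-⊕ K F G) n) (z-⊕ (F ⊛ K) (G ⊛ K) n)))
    (solve 4 (λ c v w κ → c :* (v :* κ) :+ c :* (w :* κ) := c :* ((v :+ w) :* κ)) refl ⅓ v w κ)
    (plus (evaluates-z⊛-extend f) (evaluates-z⊛-extend g))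
  evaluates-z⊛-extend (minus {F} {G} {H} {v} {w} F≗G⊕H f g) = resp-≗ (λ _ → refl)
    (solve 4 (λ c v w κ → c :* (v :* κ) :- c :* (w :* κ) := c :* ((v :- w) :* κ)) refl ⅓ v w κ)
    (minus
      (λ n → trans
        (z-cong (λ n → trans (⊛-cong {G = K} F≗G⊕H (λ _ → refl) n) (⊛-distribʳ-⊕ K G H n)) n)
        (z-⊕ (G ⊛ K) (H ⊛ K) n))
      (evaluates-z⊛-extend f) (evaluates-z⊛-extend g))
  evaluates-z⊛-extend (resp-≗ F≗G refl f) =
    resp-≗ (z-cong (⊛-cong {G = K} F≗G (λ _ → refl))) refl (evaluates-z⊛-extend f)

evaluates-z𝟙⊛ : ∀ {F v} → Evaluates F v → Evaluates (z (𝟙 ⊛ F)) (⅓ * (1ℚ * v))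
evaluates-z𝟙⊛ {F} {v} f =
  resp-≗ (z-cong (λ n → sym (⊛-identityˡ F n))) (cong (⅓ *_) (sym (*-identityˡ v))) (shift f)

-- M = z + zM + zM² expresses zM² linearly in M, with value 1 - 2/3.
evaluates-zM⊛M : Evaluates (z (M ⊛ M)) (⅓ * (1ℚ * 1ℚ))
evaluates-zM⊛M = resp-≗ (λ _ → refl) refl (minus split motzkin (shift (plus one motzkin)))
  where
  split : M ≗ z (𝟙 ⊕ M) ⊕ z (M ⊛ M)
  split n = trans (M-equation n) (trans
    (z-cong (λ n → sym (ℕ.+-assoc (𝟙 n) (M n) ((M ⊛ M) n))) n)
    (z-⊕ (𝟙 ⊕ M) (M ⊛ M) n))

-- The extension is used twice: with `K` = `M` it leads from zMM to zGM, and with `K` = `G` from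
-- there to zFG.
evaluates-z⊛ : ∀ {F G v w} → Evaluates F v → Evaluates G w → Evaluates (z (F ⊛ G)) (⅓ * (v * w))
evaluates-z⊛ {F} {G} {v} {w} f g = evaluates-z⊛-extend (evaluates-z𝟙⊛ g) zM⊛G f
  where
  zM⊛G : Evaluates (z (M ⊛ G)) (⅓ * (1ℚ * w))
  zM⊛G = resp-≗ (z-cong (⊛-comm G M)) (cong (⅓ *_) (*-comm w 1ℚ))
    (evaluates-z⊛-extend (evaluates-z𝟙⊛ motzkin) evaluates-zM⊛M g)

-- Multiplication by `U` sends the generators 1 and `M` to `U` and `P 0`, whose ratios to `U` tend
-- to 1; each other constructor matches a closure property of `_~_`.
evaluates⇒~ : ∀ {F v} → Evaluates F v → F ⊛ U ~ v
evaluates⇒~ one               = ~-cong (λ n → sym (⊛-identityˡ U n)) U~1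
evaluates⇒~ motzkin           = ~-cong P₀-M⊛U P₀~1
evaluates⇒~ (shift {F} f)     = ~-cong (λ n → sym (z-⊛ˡ F U n)) (~-z (evaluates⇒~ f))
evaluates⇒~ (plus {F} {G} f g) =
  ~-cong (λ n → sym (⊛-distribʳ-⊕ U F G n)) (~-⊕ (evaluates⇒~ f) (evaluates⇒~ g))
evaluates⇒~ (minus {F} {G} {H} F≗G⊕H f g) =
  ~-cancel (λ n → trans (⊛-cong {G = U} F≗G⊕H (λ _ → refl) n) (⊛-distribʳ-⊕ U G H n))
    (evaluates⇒~ f) (evaluates⇒~ g)
evaluates⇒~ (resp-≗ F≗G refl f) = ~-cong (⊛-cong {G = U} F≗G (λ _ → refl)) (evaluates⇒~ f)

-- Limits of the proportions

limit : ℕ → ℚ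
limit zero    = 1ℚ
limit (suc k) = ⅓ * limit k + ⅓ * (limit k * limit k)

R-evaluates : ∀ k → Evaluates (R k) (limit k)
R-evaluates zero    = motzkin
R-evaluates (suc k) = resp-≗
  (λ n → sym (trans (R-suc k n) (z-⊕ (R k) (R k ⊛ R k) n))) refl
  (plus (shift (R-evaluates k)) (evaluates-z⊛ (R-evaluates k) (R-evaluates k)))

P~limit : ∀ k → P k ~ limit k
P~limit k = ~-cong (λ n → sym (P-R⊛U k n)) (evaluates⇒~ (R-evaluates k))

-- Multiplying by t turns the error of the quotient into p - vt, and `U n` on the right is at most
-- 4t, so t cancels.
quotient-near : ∀ {n C v} p t .{{_ : ℕ.NonZero t}} → U n ℕ.≤ 4 ℕ.* t →
                Small n C (ι p - v * ι t) → ι (suc n) * ∣ (+ p / t) - v ∣ ≤ C * ι 4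
quotient-near {n} {C} {v} p t@(suc _) u≤4t (small 0≤C bound) = *-cancelʳ-≤-pos (ι t) (begin
  ι (suc n) * ∣ q - v ∣ * ι t         ≡⟨ *-assoc (ι (suc n)) ∣ q - v ∣ (ι t) ⟩
  ι (suc n) * (∣ q - v ∣ * ∣ ι t ∣)   ≡⟨ cong (ι (suc n) *_) (∣p*q∣≡∣p∣*∣q∣ (q - v) (ι t)) ⟨
  ι (suc n) * ∣ (q - v) * ι t ∣       ≡⟨ cong (λ x → ι (suc n) * ∣ x ∣) difference ⟩
  ι (suc n) * ∣ ι p - v * ι t ∣       ≤⟨ bound ⟩
  C * ι (U n)                         ≤⟨ *-monoˡ-≤-nonNeg C {{nonNegative 0≤C}} (ι-mono-≤ u≤4t) ⟩
  C * ι (4 ℕ.* t)                     ≡⟨ cong (C *_) (ι-* 4 t) ⟩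
  C * (ι 4 * ι t)                     ≡⟨ *-assoc C (ι 4) (ι t) ⟨
  C * ι 4 * ι t                       ∎)
  where
  open ≤-Reasoning
  q = + p / t
  difference : (q - v) * ι t ≡ ι p - v * ι t
  difference = trans
    (solve 3 (λ q v t → (q :- v) :* t := q :* t :- v :* t) refl q v (ι t))
    (cong (_- v * ι t) (/-*-ι p t))

-- In w (F - vU) - v (G - wU) the multiples of `U` cancel, which compares two series directly.
~-relative : ∀ {F G v w} → F ~ v → G ~ w →
             ∃[ C ] (∀ n → Small n C (w * ι (F n) - v * ι (G n)))
~-relative {F} {G} {v} {w} (within F~v) (within G~w) = _ , λ n →
  subst (Small n _)
    (solve 5 (λ f g v w u → w :* (f :- v :* u) :+ (:- v) :* (g :- w :* u) := w :* f :- v :* g) refl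
      (ι (F n)) (ι (G n)) v w (ι (U n)))
    (small-+ (small-* w (F~v n)) (small-* (- v) (G~w n)))

proportion-near : ∀ k →
  ∃[ E ] (∀ n .{{_ : ℕ.NonZero n}} → ι (suc n) * ∣ proportion k n - limit k ∣ ≤ E)
proportion-near k = proj₁ relative * ι 4 , λ n {{n≢0}} →
  quotient-near (#protected k n) (n ℕ.* #trees n)
    {{ℕ.m*n≢0 n (#trees n) {{n≢0}} {{#trees-nonZero n}}}}
    (subst (λ t → U n ℕ.≤ 4 ℕ.* t) (total n) (U≤4P₀ n))
    (subst₂ (λ f t → Small n (proj₁ relative) (f - limit k * ι t))
      (trans (*-identityˡ (ι (P k n))) (cong ι (sym (#protected-gf k n))))
      (total n) (proj₂ relative n))
  where
  relative = ~-relative {P k} {P 0} (P~limit k) P₀~1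
  total : ∀ n → P 0 n ≡ n ℕ.* #trees n
  total n = trans (P₀ n) (cong (n ℕ.*_) (sym (#trees-M n)))

-- The error E / (n + 1) is below ε as soon as n ≥ N, where N is chosen with E < ε N.
near⇒HasLimit : ∀ {a l E} → (∀ n .{{_ : ℕ.NonZero n}} → ι (suc n) * ∣ a n - l ∣ ≤ E) → HasLimit a l
near⇒HasLimit {a} {l} {E} near ε 0<ε with N , E<εN ← archimedean E ε {{positive 0<ε}} = N , λ n N≤n →
  *-cancelˡ-<-nonNeg (ι (suc n)) (begin-strict
    ι (suc n) * ∣ a n - l ∣     ≤⟨ near n ⟩
    E                           <⟨ E<εN ⟩
    ε * ι N                     ≤⟨ *-monoˡ-≤-nonNeg ε {{nonNegative (<⇒≤ 0<ε)}}
                                     (ι-mono-≤ (ℕ.m≤n⇒m≤1+n N≤n)) ⟩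
    ε * ι (suc n)               ≡⟨ *-comm ε (ι (suc n)) ⟩
    ι (suc n) * ε               ∎)
  where open ≤-Reasoning

theorem3p3 : Σ[ P ∈ (ℕ → ℚ) ]
    ((∀ k → HasLimit (proportion k) (P k)) ×
    (∀ k → k ≥ 1 → P k ≡ (+ 1 / 3) * P (k ∸ 1) + (+ 1 / 3) * (P (k ∸ 1) * P (k ∸ 1))))
theorem3p3 =
  -- The recurrence is the defining clause of `limit`; the content lies in the convergence.
  limit , (λ k → near⇒HasLimit {proportion k} (proj₂ (proportion-near k))) , λ { (suc k) _ → refl }
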